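{- Let $R$ be a jump-free (cut-free and axiom-free) proof-structure of $\mathit{ICOMLL}$ such that $R\models\mathsf{ACC}_{\sharp\mathsf w}$. Then there exists a (cut-free and axiom-free) sequent calculus proof $\pi$ in $\mathit{ICOMLL}$ such that $\pi\mathrel{|\!\!\Rightarrow}\langle R\rangle_{\mathsf w}$.
   Context: $\mathit{ICOMLL}$ formulae: $$O::=\mathbf 1\mid O\otimes O\mid O\wp I\mid I\wp O\ \text{(outputs)},\qquad I::=\bot\mid I\wp I\mid I\otimes O\mid O\otimes I\ \text{(inputs)}.$$ Sequent calculus rules (no axiom, no cut; sequents are finite sequences of $\mathit{ICOMLL}$ formulae): exchange; $\otimes$ (from $\vdash\Gamma,A$ and $\vdash B,\Delta$ infer $\vdash\Gamma,A\otimes B,\Delta$); $\vdash\mathbf 1$; $\wp$ (from $\vdash\Gamma,A,B$ infer $\vdash\Gamma,A\wp B$); $\bot$ (from $\vdash\Gamma$ infer $\vdash\Gamma,\bot$). Graphs are finite directed graphs (parallel arcs allowed, no loops); an arc is a conclusion of its tail and a premise of its head. A proof-structure (ps) of $\mathit{ICOMLL}$ is such a graph without directed cycles, with nodes labelled $\mathtt 1$ or $\bot$ (1 conclusion, no premise), $\otimes$ or $\wp$ (2 premises ordered as left and right, 1 conclusion), $\bullet$ (1 premise, no conclusion) (no $\mathtt{ax}$ or $\mathtt{cut}$ nodes), with a total order on its conclusions (the premises of $\bullet$ nodes), and arcs typed by $\mathit{ICOMLL}$ formulae: $\mathbf 1$, $\bot$, $B\otimes C$, $B\wp C$ for the conclusions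 of $\mathtt 1,\bot,\otimes,\wp$ nodes with premises of types $B$ (left), $C$ (right). In addition $R$ comes with a partial jump function $J_R$ from the set $\mathsf w(R)$ of $\bot$ nodes to the nodes of $R$; $R$ is jump-total if $J_R$ is total and jump-free if $J_R$ is empty. An arc is output/input if its type is; a node is output/input if its conclusion is. A switching $\varphi$ of $R$ maps each $\wp$ node to one of its premises; for jump-free $R$, the switching graph $R^\varphi$ is obtained by redirecting, for each $\wp$ node $n$, the head of the premise other than $\varphi(n)$ to a fresh $\bullet$ node. For jump-free $R$, $R\models\mathsf{ACC}_{\sharp\mathsf w}$ means: for every switching $\varphi$, $R^\varphi$ has no undirected cycle and has exactly $\sharp\mathsf w(R)+1$ connected components. (For ps of $\mathit{ICOMLL}$ this implies that $R$ has exactly one output conclusion.) Canonical jumps. Write $n\prec n'$ if there is a non-empty directed path from $n$ to $n'$. For an output node $m$, the node $m_\otimes$ is: $m$ itself if $m$ is a $\mathtt 1$ node or an output $\otimes$ node; and $(m')_\otimes$ if $m$ is an output $\wp$ node, $m'$ being the node whose conclusion is the unique output premise of $m$. Let $R$ be jump-free with exactly one output conclusion. $\langle R\rangle_{\mathsf w}$ is the jump-total ps obtained from $R$ by setting, for every $\bot$ node $n$, the jump of $n$ to be $m_\otimes$, where $m$ is the $\prec$-least output $\wp$ node with $n\prec m$ if there is an output $\wp$ node below $n$, and otherwise $m$ is the node whose conclusion is the unique output conclusion of $R$. Relation $\pi\mathrel{|\!\!\Rightarrow}R$ between sequent calculus proofs and jump-total ps, by induction on $\pi$: a $\mathbf 1$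 rule is related to the single $\mathtt 1$ node with conclusion pointing to a $\bullet$ node; exchange changes the order of conclusions; if $\pi_1\mathrel{|\!\!\Rightarrow}R_1$ and $\pi$ is $\pi_1$ followed by a $\bot$ rule, then $\pi\mathrel{|\!\!\Rightarrow}R$ for every $R$ obtained from $R_1$ by adding a $\bot$ node $n$ whose conclusion points to a new $\bullet$ node, with jump $J_R(n)$ an arbitrary node of $R_1$ (other jumps as in $R_1$); if $\pi$ is $\pi_1$ followed by a $\wp$ rule (resp. is obtained from $\pi_1,\pi_2$ by a $\otimes$ rule) and $\pi_i\mathrel{|\!\!\Rightarrow}R_i$, then $\pi\mathrel{|\!\!\Rightarrow}R$ where $R$ is obtained from $R_1$ (resp. the disjoint union of $R_1,R_2$) by removing the $\bullet$ nodes of the two active conclusions (these $\bullet$ nodes not being targets of jumps), making these the left and right premises of a new $\wp$ (resp. $\otimes$) node whose conclusion points to a new $\bullet$ node, and keeping all jumps. -}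

module Defs where

open import Data.Empty using (⊥-elim)
open import Data.Fin using (Fin; zero; suc; toℕ; splitAt; _↑ˡ_; _↑ʳ_)
open import Data.Fin.Induction using (spo-wellFounded; spo-noetherian)
open import Data.Fin.Permutation.Components using (transpose)
open import Data.Fin.Properties using (_≟_)
open import Data.List using (List; []; _∷_; length; filter; allFin)
open import Data.List.Relation.Unary.Unique.Propositional using (Unique)
open import Data.Maybe as Maybe using (Maybe; just; nothing)
open import Data.Nat using (ℕ; _+_)
open import Data.Product using (Σ; ∃; ∃!; _×_; _,_; proj₁; proj₂)
open import Data.Sum as Sum using (_⊎_; inj₁; inj₂; [_,_]′)
open import Data.Sum.Properties using (inj₁-injective)
open import Data.Unit using (⊤; tt)
open import Data.Vec using (Vec; []; _∷_; _++_)
open import Function using (_∘_; const; flip; _↔_; _⇔_; Inverse)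
open import Function.Definitions using (StrictlySurjective)
open import Function.Properties.Inverse using (↔⇒↣)
open import Induction.WellFounded using (Acc; acc; WellFounded; module Subrelation)
open import Level using (0ℓ)
open import Relation.Binary using (Rel; IsStrictPartialOrder; DecidableEquality)
open import Relation.Binary.Construct.Closure.Transitive as Plus using (TransClosure; [_]; _∷_)
import Relation.Binary.Construct.On as On
open import Relation.Binary.PropositionalEquality
  using (_≡_; _≢_; refl; sym; cong; subst; isEquivalence)
open import Relation.Nullary using (¬_; Dec; yes; no)
open import Relation.Nullary.Decidable using (via-injection)

infixr 7 _⊗_
infixr 6 _⅋_
infix  4 ⊢_ _∣⇒_ _≅_

Finite : Set → Set
Finite A = ∃ λ n → A ↔ Fin n

data Formula : Set where
  𝟏 ⟂     : Formula
  _⊗_ _⅋_ : Formula → Formula → Formula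

mutual
  data Output : Formula → Set where
    𝟏   : Output 𝟏
    O⊗O : ∀ {A B} → Output A → Output B → Output (A ⊗ B)
    O⅋I : ∀ {A B} → Output A → Input B → Output (A ⅋ B)
    I⅋O : ∀ {A B} → Input A → Output B → Output (A ⅋ B)

  data Input : Formula → Set where
    ⟂   : Input ⟂
    I⅋I : ∀ {A B} → Input A → Input B → Input (A ⅋ B)
    I⊗O : ∀ {A B} → Input A → Output B → Input (A ⊗ B)
    O⊗I : ∀ {A B} → Output A → Input B → Input (A ⊗ B)

ICOMLL : Formula → Set
ICOMLL A = Output A ⊎ Input A

-- Unrestricted formulae are not always in ICOMLL (for instance ⟂ ⊗ ⟂), so the
-- two rules that build a formula require their principal formula to be.  Hence
-- every formula of a derivable sequent is in ICOMLL.

data ⊢_ : ∀ {n} → Vec Formula n → Set where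
  exchange : ∀ {k l} (Γ : Vec Formula k) A B (Δ : Vec Formula l) →
             ⊢ (Γ ++ A ∷ B ∷ Δ) → ⊢ (Γ ++ B ∷ A ∷ Δ)
  tensor   : ∀ {k l} (Γ : Vec Formula k) A B (Δ : Vec Formula l) → ICOMLL (A ⊗ B) →
             ⊢ (Γ ++ A ∷ []) → ⊢ (B ∷ Δ) → ⊢ (Γ ++ A ⊗ B ∷ Δ)
  one      : ⊢ (𝟏 ∷ [])
  par      : ∀ {k} (Γ : Vec Formula k) A B → ICOMLL (A ⅋ B) →
             ⊢ (Γ ++ A ∷ B ∷ []) → ⊢ (Γ ++ A ⅋ B ∷ [])
  bot      : ∀ {k} (Γ : Vec Formula k) → ⊢ Γ → ⊢ (Γ ++ ⟂ ∷ [])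

record Graph : Set₁ where
  field
    Node Arc  : Set
    tail head : Arc → Node

module _ (G : Graph) where
  open Graph G

  Step : Rel Node 0ℓ
  Step u v = ∃ λ e → tail e ≡ u × head e ≡ v

  DirectedPath⁺ : Rel Node 0ℓ
  DirectedPath⁺ = TransClosure Step

  Joins : Arc → Node → Node → Set
  Joins e u v = (tail e ≡ u × head e ≡ v) ⊎ (tail e ≡ v × head e ≡ u)

  data UndirectedPath : Node → Node → Set where
    []  : ∀ {u} → UndirectedPath u u
    _∷_ : ∀ {u v w} → (∃ λ e → Joins e u v) → UndirectedPath v w → UndirectedPath u w

  traversedArcs : ∀ {u v} → UndirectedPath u v → List Arc
  traversedArcs []            = []
  traversedArcs ((e , _) ∷ p) = e ∷ traversedArcs p

  -- All the nodes visited, except the last one.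
  traversedNodes : ∀ {u v} → UndirectedPath u v → List Node
  traversedNodes []          = []
  traversedNodes {u} (_ ∷ p) = u ∷ traversedNodes p

  UndirectedCycle : Set
  UndirectedCycle = ∃ λ v → Σ (UndirectedPath v v) λ p →
    traversedArcs p ≢ [] × Unique (traversedArcs p) × Unique (traversedNodes p)

  HasConnectedComponents : ℕ → Set
  HasConnectedComponents k = Σ (Node → Fin k) λ component →
    StrictlySurjective _≡_ component ×
    (∀ u v → component u ≡ component v ⇔ UndirectedPath u v)

data Label : Set where
  one bot tensor par : Label

arity : Label → ℕ
arity one    = 0
arity bot    = 0
arity tensor = 2
arity par    = 2

conclusionType : (ℓ : Label) → (Fin (arity ℓ) → Formula) → Formula
conclusionType one    A = 𝟏
conclusionType bot    A = ⟂
conclusionType tensor A = A zero ⊗ A (suc zero)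
conclusionType par    A = A zero ⅋ A (suc zero)

bot? : (ℓ : Label) → Dec (ℓ ≡ bot)
bot? one    = no λ ()
bot? bot    = yes refl
bot? tensor = no λ ()
bot? par    = no λ ()

par? : (ℓ : Label) → Dec (ℓ ≡ par)
par? one    = no λ ()
par? bot    = no λ ()
par? tensor = no λ ()
par? par    = yes refl

-- The data of a proof-structure with n conclusions, without its laws.  A cell
-- is a node labelled 1, ⊥, ⊗ or ⅋.  The • nodes are the elements of Fin n, the
-- order of Fin n being the order of the conclusions.  The left and right
-- premises of a binary cell c are premise c 0 and premise c 1, and
-- conclusion i is the premise of the i-th • node.

record Structure (n : ℕ) : Set₁ where
  field
    Cell Arc : Set

  Node : Set
  Node = Cell ⊎ Fin n

  field
    label      : Cell → Label
    tail       : Arc → Cell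
    head       : Arc → Node
    premise    : ∀ c → Fin (arity (label c)) → Arc
    conclusion : Fin n → Arc
    type       : Arc → Formula
    jump       : ∀ c → label c ≡ bot → Maybe Node

  graph : Graph
  graph = record { Node = Node ; Arc = Arc ; tail = inj₁ ∘ tail ; head = head }

  _≺_ : Rel Node 0ℓ
  _≺_ = DirectedPath⁺ graph

record IsProofStructure {n} (S : Structure n) : Set where
  open Structure S
  field
    cells-finite     : Finite Cell
    arcs-finite      : Finite Arc
    acyclic          : ∀ v → ¬ v ≺ v
    one-conclusion   : ∀ c → ∃! _≡_ λ e → tail e ≡ c
    premise-head     : ∀ c i → head (premise c i) ≡ inj₁ c
    premise-unique   : ∀ c e → head e ≡ inj₁ c → ∃! _≡_ λ i → premise c i ≡ e
    conclusion-head  : ∀ i → head (conclusion i) ≡ inj₂ i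
    conclusion-only  : ∀ i e → head e ≡ inj₂ i → conclusion i ≡ e
    typed            : ∀ e → type e ≡ conclusionType (label (tail e)) (type ∘ premise (tail e))
    icomll           : ∀ e → ICOMLL (type e)

record ProofStructure (n : ℕ) : Set₁ where
  field
    structure        : Structure n
    isProofStructure : IsProofStructure structure
  open Structure structure public
  open IsProofStructure isProofStructure public

  conclusionOf : Cell → Arc
  conclusionOf c = proj₁ (one-conclusion c)

  _≟ᴬ_ : DecidableEquality Arc
  _≟ᴬ_ = via-injection (↔⇒↣ (proj₂ arcs-finite)) _≟_

  ♯w : ℕ
  ♯w = length (filter (λ i → bot? (label (Inverse.from (proj₂ cells-finite) i)))
                      (allFin (proj₁ cells-finite)))

JumpFree : ∀ {n} → ProofStructure n → Set
JumpFree R = ∀ c p → jump c p ≡ nothing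
  where open ProofStructure R

module _ {n} (R : ProofStructure n) where
  open ProofStructure R

  ParCell : Set
  ParCell = ∃ λ c → label c ≡ par

  Switching : Set
  Switching = (m : ParCell) → ∃ λ e → head e ≡ inj₁ (proj₁ m)

  -- The fresh • node associated with the ⅋ node m is inj₂ m.
  switchedHead : Switching → Arc → Node ⊎ ParCell
  switchedHead φ e with head e
  ... | inj₂ i = inj₁ (inj₂ i)
  ... | inj₁ c with par? (label c)
  ...   | no  _ = inj₁ (inj₁ c)
  ...   | yes p with e ≟ᴬ proj₁ (φ (c , p))
  ...     | yes _ = inj₁ (inj₁ c)
  ...     | no  _ = inj₂ (c , p)

  switchingGraph : Switching → Graph
  switchingGraph φ = record
    { Node = Node ⊎ ParCell
    ; Arc  = Arc
    ; tail = inj₁ ∘ inj₁ ∘ tail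
    ; head = switchedHead φ
    }

  ACC♯w : Set
  ACC♯w = ∀ φ → ¬ UndirectedCycle (switchingGraph φ) ×
                HasConnectedComponents (switchingGraph φ) (♯w + 1)

module _ {n} (R : ProofStructure n) where
  open ProofStructure R

  UniqueOutput : Set
  UniqueOutput = ∃! _≡_ λ i → Output (type (conclusion i))

  OutputCell : Cell → Set
  OutputCell c = Output (type (conclusionOf c))

  OutputPar : Cell → Set
  OutputPar c = label c ≡ par × OutputCell c

  -- TensorOf m t says that t is m_⊗.
  data TensorOf : Cell → Cell → Set where
    one    : ∀ {m} → label m ≡ one → TensorOf m m
    tensor : ∀ {m} → label m ≡ tensor → OutputCell m → TensorOf m m
    par    : ∀ {m t} → OutputPar m → (i : Fin (arity (label m))) →
             Output (type (premise m i)) → TensorOf (tail (premise m i)) t → TensorOf m t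

  IsLeastOutputParBelow : Cell → Cell → Set
  IsLeastOutputParBelow c m = OutputPar m × inj₁ c ≺ inj₁ m ×
    (∀ m′ → OutputPar m′ → inj₁ c ≺ inj₁ m′ → m ≡ m′ ⊎ inj₁ m ≺ inj₁ m′)

  NoOutputParBelow : Cell → Set
  NoOutputParBelow c = ∀ m → OutputPar m → ¬ inj₁ c ≺ inj₁ m

  data CanonicalJump (o : UniqueOutput) (c : Cell) : Cell → Set where
    below   : ∀ {m t} → IsLeastOutputParBelow c m → TensorOf m t → CanonicalJump o c t
    default : ∀ {t} → NoOutputParBelow c → TensorOf (tail (conclusion (proj₁ o))) t →
              CanonicalJump o c t

  -- Canonical jumps exist because ≺ is well founded in both directions.

  private
    _≺ᶜ_ : Rel Cell 0ℓ
    c ≺ᶜ d = inj₁ c ≺ inj₁ d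

    cells : Cell ↔ Fin (proj₁ cells-finite)
    cells = proj₂ cells-finite

    to   = Inverse.to cells
    from = Inverse.from cells

    _⊏_ : Rel (Fin (proj₁ cells-finite)) 0ℓ
    i ⊏ j = from i ≺ᶜ from j

    ⊏-spo : IsStrictPartialOrder _≡_ _⊏_
    ⊏-spo = record
      { isEquivalence = isEquivalence
      ; irrefl        = λ { refl p → acyclic _ p }
      ; trans         = Plus._++_
      ; <-resp-≈      = (λ { refl p → p }) , (λ { refl p → p })
      }

    ≺⇒⊏ : ∀ {c d} → c ≺ᶜ d → to c ⊏ to d
    ≺⇒⊏ {c} {d} p
      rewrite Inverse.strictlyInverseʳ cells c | Inverse.strictlyInverseʳ cells d = p

  ≺-wellFounded : WellFounded _≺ᶜ_
  ≺-wellFounded = Subrelation.wellFounded ≺⇒⊏ (On.wellFounded to (spo-wellFounded ⊏-spo))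

  ≻-wellFounded : WellFounded (flip _≺ᶜ_)
  ≻-wellFounded = Subrelation.wellFounded ≺⇒⊏ (On.wellFounded to (spo-noetherian ⊏-spo))

  conclusionOf-tail : ∀ e → conclusionOf (tail e) ≡ e
  conclusionOf-tail e = proj₂ (proj₂ (one-conclusion (tail e))) refl

  tail-conclusionOf : ∀ c → tail (conclusionOf c) ≡ c
  tail-conclusionOf c = proj₁ (proj₂ (one-conclusion c))

  conclusionOf-unique : ∀ {c e} → tail e ≡ c → conclusionOf c ≡ e
  conclusionOf-unique {c} = proj₂ (proj₂ (one-conclusion c))

  output-input : ∀ {A} → Output A → ¬ Input A
  output-input (O⊗O a b) (I⊗O a′ b′) = output-input a a′
  output-input (O⊗O a b) (O⊗I a′ b′) = output-input b b′
  output-input (O⅋I a b) (I⅋I a′ b′) = output-input a a′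
  output-input (I⅋O a b) (I⅋I a′ b′) = output-input b b′

  output? : ∀ e → Dec (Output (type e))
  output? e with icomll e
  ... | inj₁ o = yes o
  ... | inj₂ i = no λ o → output-input o i

  outputPar? : ∀ c → Dec (OutputPar c)
  outputPar? c with par? (label c) | output? (conclusionOf c)
  ... | yes p | yes o = yes (p , o)
  ... | no ¬p | _     = no λ (p , _) → ¬p p
  ... | _     | no ¬o = no λ (_ , o) → ¬o o

  typed-cell : ∀ c → type (conclusionOf c) ≡ conclusionType (label c) (type ∘ premise c)
  typed-cell c = subst
    (λ d → type (conclusionOf c) ≡ conclusionType (label d) (type ∘ premise d))
    (tail-conclusionOf c) (typed (conclusionOf c))

  outputLabel : ∀ ℓ (A : Fin (arity ℓ) → Formula) → Output (conclusionType ℓ A) →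
                ℓ ≡ one ⊎ ℓ ≡ tensor ⊎ (ℓ ≡ par × ∃ λ i → Output (A i))
  outputLabel one    A o         = inj₁ refl
  outputLabel tensor A o         = inj₂ (inj₁ refl)
  outputLabel par    A (O⅋I a _) = inj₂ (inj₂ (refl , zero , a))
  outputLabel par    A (I⅋O _ b) = inj₂ (inj₂ (refl , suc zero , b))

  tensorOf-acc : ∀ m → Acc _≺ᶜ_ m → OutputCell m → ∃ (TensorOf m)
  tensorOf-acc m (acc rs) o
    with outputLabel (label m) (type ∘ premise m) (subst Output (typed-cell m) o)
  ... | inj₁ p                   = m , one p
  ... | inj₂ (inj₁ p)            = m , tensor p o
  ... | inj₂ (inj₂ (p , i , o′)) =
    let m′ = tail (premise m i)
        t , d = tensorOf-acc m′ (rs [ premise m i , refl , premise-head m i ])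
                  (subst (Output ∘ type) (sym (conclusionOf-tail _)) o′)
    in t , par (p , o) i o′ d

  tensorOf : ∀ m → OutputCell m → ∃ (TensorOf m)
  tensorOf m = tensorOf-acc m (≺-wellFounded m)

  first-step : ∀ {c v w} → head (conclusionOf c) ≡ v → inj₁ c ≺ w → v ≡ w ⊎ v ≺ w
  first-step h [ e , t , refl ]
    with refl ← conclusionOf-unique (inj₁-injective t) = inj₁ (sym h)
  first-step h ((e , t , refl) ∷ p)
    with refl ← conclusionOf-unique (inj₁-injective t) = inj₂ (subst (_≺ _) h p)

  bullet-final : ∀ {i w} → ¬ inj₂ i ≺ w
  bullet-final [ _ , () , _ ]
  bullet-final ((_ , () , _) ∷ _)

  search : ∀ c → Acc (flip _≺ᶜ_) c → ∃ (IsLeastOutputParBelow c) ⊎ NoOutputParBelow c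
  search c (acc rs) with head (conclusionOf c) in h
  ... | inj₂ i = inj₂ λ m _ p → [ (λ ()) , bullet-final ]′ (first-step h p)
  ... | inj₁ d with outputPar? d
  ...   | yes o = inj₁ (d , o , [ conclusionOf c , cong inj₁ (tail-conclusionOf c) , h ] ,
                        λ _ _ p → Sum.map₁ inj₁-injective (first-step h p))
  ...   | no ¬o with search d (rs [ conclusionOf c , cong inj₁ (tail-conclusionOf c) , h ])
  ...     | inj₁ (m , o , p , least) =
    inj₁ (m , o , (conclusionOf c , cong inj₁ (tail-conclusionOf c) , h) ∷ p ,
          λ m′ o′ p′ → [ (λ { refl → ⊥-elim (¬o o′) }) , least m′ o′ ]′ (first-step h p′))
  ...     | inj₂ none =
    inj₂ λ m o p → [ (λ { refl → ¬o o }) , none m o ]′ (first-step h p)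

  canonicalJump : ∀ o c → ∃ (CanonicalJump o c)
  canonicalJump o c with search c (≻-wellFounded c)
  ... | inj₁ (m , l) =
    let t , d = tensorOf m (proj₂ (proj₁ l)) in t , below l d
  ... | inj₂ none    =
    let t , d = tensorOf (tail (conclusion (proj₁ o)))
                  (subst (Output ∘ type) (sym (conclusionOf-tail _)) (proj₁ (proj₂ o)))
    in t , default none d

  ⟨_⟩w : UniqueOutput → ProofStructure n
  ⟨_⟩w o = record
    { structure = record
      { Structure structure
      ; jump = λ c _ → just (inj₁ (proj₁ (canonicalJump o c)))
      }
    ; isProofStructure = record { IsProofStructure isProofStructure }
    }

oneStructure : Structure 1
oneStructure = record
  { Cell       = ⊤
  ; Arc        = ⊤
  ; label      = λ _ → one
  ; tail       = λ _ → tt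
  ; head       = λ _ → inj₂ zero
  ; premise    = λ _ ()
  ; conclusion = λ _ → tt
  ; type       = λ _ → 𝟏
  ; jump       = λ _ ()
  }

exchangeStructure : ∀ k l → Structure (k + (2 + l)) → Structure (k + (2 + l))
exchangeStructure k l S = record
  { Structure S using (Cell; Arc; label; tail; premise; type)
  ; head       = Sum.map₂ τ ∘ head
  ; conclusion = conclusion ∘ τ
  ; jump       = λ c → Maybe.map (Sum.map₂ τ) ∘ jump c
  }
  where
  open Structure S
  τ : Fin (k + (2 + l)) → Fin (k + (2 + l))
  τ = transpose (k ↑ʳ zero) (k ↑ʳ suc zero)

-- In the next three operations the new cell and its conclusion are inj₂ tt.

botStructure : ∀ {k} (S : Structure k) → Structure.Node S → Structure (k + 1)
botStructure {k} S target = record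
  { Cell       = Cell ⊎ ⊤
  ; Arc        = Arc ⊎ ⊤
  ; label      = [ label , const bot ]′
  ; tail       = Sum.map₁ tail
  ; head       = [ node ∘ head , (λ _ → inj₂ (k ↑ʳ zero)) ]′
  ; premise    = λ { (inj₁ c) i → inj₁ (premise c i) ; (inj₂ tt) () }
  ; conclusion = Sum.map conclusion (const tt) ∘ splitAt k
  ; type       = [ type , const ⟂ ]′
  ; jump       = λ { (inj₁ c)  → Maybe.map node ∘ jump c
                   ; (inj₂ tt) → λ _ → just (node target) }
  }
  where
  open Structure S
  node : Node → (Cell ⊎ ⊤) ⊎ Fin (k + 1)
  node = Sum.map inj₁ (_↑ˡ 1)

-- The • nodes that are removed are sent to the new cell, which is where their
-- premises are redirected.

parStructure : ∀ k → Structure (k + 2) → Structure (k + 1)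
parStructure k S = record
  { Cell       = Cell ⊎ ⊤
  ; Arc        = Arc ⊎ ⊤
  ; label      = [ label , const par ]′
  ; tail       = Sum.map₁ tail
  ; head       = [ node ∘ head , (λ _ → inj₂ (k ↑ʳ zero)) ]′
  ; premise    = λ { (inj₁ c) i → inj₁ (premise c i)
                   ; (inj₂ tt) i → inj₁ (active i) }
  ; conclusion = Sum.map (conclusion ∘ (_↑ˡ 2)) (const tt) ∘ splitAt k
  ; type       = [ type , (λ _ → type (active zero) ⅋ type (active (suc zero))) ]′
  ; jump       = λ { (inj₁ c) → Maybe.map node ∘ jump c ; (inj₂ tt) () }
  }
  where
  open Structure S
  active : Fin 2 → Arc
  active i = conclusion (k ↑ʳ i)
  node : Node → (Cell ⊎ ⊤) ⊎ Fin (k + 1)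
  node (inj₁ c) = inj₁ (inj₁ c)
  node (inj₂ i) = [ (λ j → inj₂ (j ↑ˡ 1)) , (λ _ → inj₁ (inj₂ tt)) ]′ (splitAt k i)

tensorStructure : ∀ k l → Structure (k + 1) → Structure (1 + l) → Structure (k + (1 + l))
tensorStructure k l S₁ S₂ = record
  { Cell       = (S₁.Cell ⊎ S₂.Cell) ⊎ ⊤
  ; Arc        = (S₁.Arc ⊎ S₂.Arc) ⊎ ⊤
  ; label      = [ [ S₁.label , S₂.label ]′ , const tensor ]′
  ; tail       = Sum.map₁ (Sum.map S₁.tail S₂.tail)
  ; head       = [ [ node₁ ∘ S₁.head , node₂ ∘ S₂.head ]′ , (λ _ → inj₂ (k ↑ʳ zero)) ]′
  ; premise    = λ { (inj₁ (inj₁ c)) i → inj₁ (inj₁ (S₁.premise c i))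
                   ; (inj₁ (inj₂ c)) i → inj₁ (inj₂ (S₂.premise c i))
                   ; (inj₂ tt) zero       → inj₁ (inj₁ active₁)
                   ; (inj₂ tt) (suc zero) → inj₁ (inj₂ active₂) }
  ; conclusion = [ (λ i → inj₁ (inj₁ (S₁.conclusion (i ↑ˡ 1))))
                 , (λ { zero    → inj₂ tt
                      ; (suc i) → inj₁ (inj₂ (S₂.conclusion (suc i))) })
                 ]′ ∘ splitAt k
  ; type       = [ [ S₁.type , S₂.type ]′ , (λ _ → S₁.type active₁ ⊗ S₂.type active₂) ]′
  ; jump       = λ { (inj₁ (inj₁ c)) → Maybe.map node₁ ∘ S₁.jump c
                   ; (inj₁ (inj₂ c)) → Maybe.map node₂ ∘ S₂.jump c
                   ; (inj₂ tt) () }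
  }
  where
  module S₁ = Structure S₁
  module S₂ = Structure S₂
  active₁ : S₁.Arc
  active₁ = S₁.conclusion (k ↑ʳ zero)
  active₂ : S₂.Arc
  active₂ = S₂.conclusion zero
  node₁ : S₁.Node → ((S₁.Cell ⊎ S₂.Cell) ⊎ ⊤) ⊎ Fin (k + (1 + l))
  node₁ (inj₁ c) = inj₁ (inj₁ (inj₁ c))
  node₁ (inj₂ i) = [ (λ j → inj₂ (j ↑ˡ (1 + l))) , (λ _ → inj₁ (inj₂ tt)) ]′ (splitAt k i)
  node₂ : S₂.Node → ((S₁.Cell ⊎ S₂.Cell) ⊎ ⊤) ⊎ Fin (k + (1 + l))
  node₂ (inj₁ c)       = inj₁ (inj₁ (inj₂ c))
  node₂ (inj₂ zero)    = inj₁ (inj₂ tt)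
  node₂ (inj₂ (suc i)) = inj₂ (k ↑ʳ suc i)

-- The i-th • node of S corresponds to the i-th • node of T.
record _≅_ {n} (S T : Structure n) : Set where
  private
    module S = Structure S
    module T = Structure T
  field
    cells : S.Cell ↔ T.Cell
    arcs  : S.Arc ↔ T.Arc

  cell : S.Cell → T.Cell
  cell = Inverse.to cells
  arc : S.Arc → T.Arc
  arc = Inverse.to arcs
  node : S.Node → T.Node
  node = Sum.map₁ cell

  field
    label      : ∀ c → T.label (cell c) ≡ S.label c
    tail       : ∀ e → T.tail (arc e) ≡ cell (S.tail e)
    head       : ∀ e → T.head (arc e) ≡ node (S.head e)
    premise    : ∀ c i j → toℕ i ≡ toℕ j → T.premise (cell c) j ≡ arc (S.premise c i)
    conclusion : ∀ i → T.conclusion i ≡ arc (S.conclusion i)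
    type       : ∀ e → T.type (arc e) ≡ S.type e
    jump       : ∀ c p q → T.jump (cell c) q ≡ Maybe.map node (S.jump c p)

NoJumpTo : ∀ {n} → ProofStructure n → Fin n → Set
NoJumpTo R i = ∀ c p → jump c p ≢ just (inj₂ i)
  where open ProofStructure R

-- Proof-structures are considered up to isomorphism.  Those in the relation are
-- jump-total, and the types of their conclusions form the sequent proved.

data _∣⇒_ : ∀ {n} {Γ : Vec Formula n} → ⊢ Γ → ProofStructure n → Set₁ where
  one      : (R : ProofStructure 1) →
             ProofStructure.structure R ≅ oneStructure →
             one ∣⇒ R
  exchange : ∀ {k l} {Γ : Vec Formula k} {A B} {Δ : Vec Formula l}
             {π : ⊢ (Γ ++ A ∷ B ∷ Δ)} {R₁} → π ∣⇒ R₁ →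
             (R : ProofStructure (k + (2 + l))) →
             ProofStructure.structure R ≅ exchangeStructure k l (ProofStructure.structure R₁) →
             exchange Γ A B Δ π ∣⇒ R
  bot      : ∀ {k} {Γ : Vec Formula k} {π : ⊢ Γ} {R₁} → π ∣⇒ R₁ →
             (target : ProofStructure.Node R₁) →
             (R : ProofStructure (k + 1)) →
             ProofStructure.structure R ≅ botStructure (ProofStructure.structure R₁) target →
             bot Γ π ∣⇒ R
  par      : ∀ {k} {Γ : Vec Formula k} {A B} {w : ICOMLL (A ⅋ B)}
             {π : ⊢ (Γ ++ A ∷ B ∷ [])} {R₁} → π ∣⇒ R₁ →
             (∀ i → NoJumpTo R₁ (k ↑ʳ i)) →
             (R : ProofStructure (k + 1)) →
             ProofStructure.structure R ≅ parStructure k (ProofStructure.structure R₁) →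
             par Γ A B w π ∣⇒ R
  tensor   : ∀ {k l} {Γ : Vec Formula k} {A B} {Δ : Vec Formula l} {w : ICOMLL (A ⊗ B)}
             {π₁ : ⊢ (Γ ++ A ∷ [])} {π₂ : ⊢ (B ∷ Δ)} {R₁ R₂} → π₁ ∣⇒ R₁ → π₂ ∣⇒ R₂ →
             NoJumpTo R₁ (k ↑ʳ zero) → NoJumpTo R₂ zero →
             (R : ProofStructure (k + (1 + l))) →
             ProofStructure.structure R ≅
               tensorStructure k l (ProofStructure.structure R₁) (ProofStructure.structure R₂) →
             tensor Γ A B Δ w π₁ π₂ ∣⇒ R

{-# OPTIONS --safe #-}
-- Without axioms R is the forest of the trees of the types of its conclusions.
-- A switching graph is again a forest, with one component for each • node, so the
-- correctness criterion compares the number of ⟂ with that of ⅋.  An output formula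
-- has as many ⟂ as ⅋ and an input formula has one more, hence exactly one
-- conclusion is an output.
--
-- A derivable forest stays derivable when the tree of an input formula I is added
-- and those ⟂ of I that lie above no output ⅋ of I jump to any fixed node: add
-- both parts of I ⅋ I; for I ⊗ O, add I and then combine with a separate derivation
-- of O.  The tree of an output formula is derivable with its canonical jumps: for
-- O ⅋ I, derive O and add I with all these jumps going to m_⊗, where m is the root
-- of O.  Finally the inputs of R are added to its output in the same way.

module Submission where

open import Data.Empty using (⊥; ⊥-elim)
open import Data.Fin using (Fin; zero; suc; toℕ; splitAt; _↑ˡ_; _↑ʳ_; punchIn; punchOut; inject₁)
open import Data.Fin.Permutation as Perm using (Permutation′; ↔⇒≡)
open import Data.Fin.Permutation.Components using (transpose; transpose-inverse)
import Data.Fin.Permutation.Transposition.List as Transpositions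
open import Data.Fin.Properties
  using (_≟_; +↔⊎; 0↔⊥; 1↔⊤; splitAt-↑ˡ; splitAt-↑ʳ; toℕ-injective; toℕ-inject₁;
         punchInᵢ≢i; punchIn-punchOut; punchOut-cong; punchOut-punchIn)
open import Data.List using ([]; _∷_; length; filter; tabulate)
open import Data.Maybe as Maybe using (Maybe; just; nothing; maybe′)
open import Data.Nat using (ℕ; zero; suc; _+_; _<_; z≤n; s≤s)
open import Data.Nat.Properties as ℕ using (+-comm; +-suc; +-identityʳ; <-irrefl; <-trans; n<1+n)
open import Algebra.Properties.CommutativeMonoid.Sum ℕ.+-0-commutativeMonoid
  using (sum; sum-cong-≗; ∑-distrib-+)
open import Data.Product using (Σ; Σ-syntax; ∃; ∃!; _×_; _,_; proj₁; proj₂)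
open import Data.Product.Function.Dependent.Propositional using (Σ-↔)
open import Data.Sum as Sum using (_⊎_; inj₁; inj₂; [_,_]′)
open import Data.Sum.Function.Propositional using (_⊎-↔_)
open import Data.Sum.Properties using (inj₁-injective; inj₂-injective)
open import Data.Unit using (⊤; tt)
open import Data.Vec as Vec using (Vec; []; _∷_; _++_; lookup)
open import Data.Vec.Properties using (lookup-splitAt; lookup-++ˡ; lookup-++ʳ)
open import Function using (_∘_; const; flip; id; _↔_; Inverse; mk↔ₛ′; Equivalence)
open import Function.Construct.Composition using () renaming (_↔-∘_ to infixr 8 _↔-∘_)
open import Function.Construct.Identity using (↔-id)
open import Function.Construct.Symmetry using (↔-sym)
open import Induction.WellFounded using (Acc; acc)
open import Relation.Binary.Construct.Closure.Transitive as Plus using ([_]; _∷_)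
open import Relation.Binary.Definitions using (tri<; tri≈; tri>)
open import Relation.Binary.PropositionalEquality
  using (_≡_; _≢_; refl; sym; trans; cong; cong₂; subst; module ≡-Reasoning)
open import Relation.Nullary using (¬_; yes; no)
open import Defs

-- The ⟂ rule jumps only to a node of its premise, so a target must be built before the ⟂ that jump
-- to it. This is why canonical jumps go to m_⊗ and not to m: when the input premise of an output ⅋
-- is added, the ⅋ does not exist yet, but m_⊗ does, being the source of the output premise or a
-- node above it.
--
-- Both premises of an output ⊗ are outputs, so along a path upwards an output turns into an input
-- only at a ⅋. Hence a ⟂ in an output formula always has an output ⅋ of that formula below it, and
-- its jump stays inside: the formula has a derivation without context, as the ⊗ rules need. Only
-- inputs have jumps that leave their tree, and the induction on them keeps the target arbitrary.
--
-- The rules of `∣⇒` also fix the places of their active formulae. Forests therefore carry an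
-- unordered set of trees, and provability is shown not to depend on the enumeration. Jumps are
-- computed on positions, and agree with those of `⟨ R ⟩w` because `CanonicalJump` is deterministic.

lab : Formula → Label
lab 𝟏       = one
lab ⟂       = bot
lab (_ ⊗ _) = tensor
lab (_ ⅋ _) = par

child : ∀ A → Fin (arity (lab A)) → Formula
child (A ⊗ B) zero       = A
child (A ⊗ B) (suc zero) = B
child (A ⅋ B) zero       = A
child (A ⅋ B) (suc zero) = B

conclusionType-cong : ∀ ℓ {f g : Fin (arity ℓ) → Formula} → (∀ i → f i ≡ g i) →
                      conclusionType ℓ f ≡ conclusionType ℓ g
conclusionType-cong one    h = refl
conclusionType-cong bot    h = refl
conclusionType-cong tensor h = cong₂ _⊗_ (h zero) (h (suc zero))
conclusionType-cong par    h = cong₂ _⅋_ (h zero) (h (suc zero))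

conclusionType-child : ∀ A → conclusionType (lab A) (child A) ≡ A
conclusionType-child 𝟏       = refl
conclusionType-child ⟂       = refl
conclusionType-child (_ ⊗ _) = refl
conclusionType-child (_ ⅋ _) = refl

child-icomll : ∀ A i → ICOMLL A → ICOMLL (child A i)
child-icomll _ zero       (inj₁ (O⊗O a b)) = inj₁ a
child-icomll _ (suc zero) (inj₁ (O⊗O a b)) = inj₁ b
child-icomll _ zero       (inj₁ (O⅋I a b)) = inj₁ a
child-icomll _ (suc zero) (inj₁ (O⅋I a b)) = inj₂ b
child-icomll _ zero       (inj₁ (I⅋O a b)) = inj₂ a
child-icomll _ (suc zero) (inj₁ (I⅋O a b)) = inj₁ b
child-icomll _ zero       (inj₂ (I⅋I a b)) = inj₂ a
child-icomll _ (suc zero) (inj₂ (I⅋I a b)) = inj₂ b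
child-icomll _ zero       (inj₂ (I⊗O a b)) = inj₂ a
child-icomll _ (suc zero) (inj₂ (I⊗O a b)) = inj₁ b
child-icomll _ zero       (inj₂ (O⊗I a b)) = inj₁ a
child-icomll _ (suc zero) (inj₂ (O⊗I a b)) = inj₂ b

-- Occurrences of subformulae are paths from the root; Snoc sees them as paths
-- that are extended at their far end, one premise at a time.

data Pos (A : Formula) : Set where
  root : Pos A
  sub  : (i : Fin (arity (lab A))) → Pos (child A i) → Pos A

at : ∀ {A} → Pos A → Formula
at {A} root  = A
at (sub i p) = at p

labelAt : ∀ {A} → Pos A → Label
labelAt p = lab (at p)

parent : ∀ {A} → Pos A → Maybe (Pos A)
parent root      = nothing
-- If `p` is the root of the premise, the parent is the root of the whole formula; this is the
-- default value.
parent (sub i p) = just (maybe′ (sub i) root (parent p))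

premiseAt : ∀ {A} (p : Pos A) → Fin (arity (labelAt p)) → Pos A
premiseAt root      i = sub i root
premiseAt (sub i p) j = sub i (premiseAt p j)

depth : ∀ {A} → Pos A → ℕ
depth root      = 0
depth (sub i p) = suc (depth p)

data Snoc {A : Formula} : Pos A → Set where
  root : Snoc root
  step : ∀ {p} → Snoc p → ∀ j → Snoc (premiseAt p j)

snoc-sub : ∀ {A} i {p : Pos (child A i)} → Snoc p → Snoc (sub {A} i p)
snoc-sub i root       = step root i
snoc-sub i (step s j) = step (snoc-sub i s) j

snoc : ∀ {A} (p : Pos A) → Snoc p
snoc root      = root
snoc (sub i p) = snoc-sub i (snoc p)

at-premiseAt : ∀ {A} (p : Pos A) j → at (premiseAt p j) ≡ child (at p) j
at-premiseAt root      j = refl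
at-premiseAt (sub i p) j = at-premiseAt p j

parent-premiseAt : ∀ {A} (p : Pos A) j → parent (premiseAt p j) ≡ just p
parent-premiseAt root      j = refl
parent-premiseAt (sub i p) j = cong (just ∘ maybe′ (sub i) root) (parent-premiseAt p j)

depth-premiseAt : ∀ {A} (p : Pos A) j → depth (premiseAt p j) ≡ suc (depth p)
depth-premiseAt root      j = refl
depth-premiseAt (sub i p) j = cong suc (depth-premiseAt p j)

premiseAt-injective : ∀ {A} (p : Pos A) {i j} → premiseAt p i ≡ premiseAt p j → i ≡ j
premiseAt-injective root      refl = refl
premiseAt-injective (sub i p) eq   = premiseAt-injective p (sub-injective eq)
  where
  sub-injective : ∀ {A i} {p q : Pos (child A i)} → sub {A} i p ≡ sub i q → p ≡ q
  sub-injective refl = refl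

parent-just : ∀ {A} (p : Pos A) {q} → parent p ≡ just q → ∃ λ j → premiseAt q j ≡ p
parent-just p eq with snoc p
... | step {p′} s j with refl ← trans (sym (parent-premiseAt p′ j)) eq = j , refl

at-icomll : ∀ {A} (p : Pos A) → ICOMLL A → ICOMLL (at p)
at-icomll     root      w = w
at-icomll {A} (sub i p) w = at-icomll p (child-icomll A i w)

-- Finiteness and weighted counting of occurrences

Σ-Fin : ∀ {n} (f : Fin n → ℕ) → Σ (Fin n) (Fin ∘ f) ↔ Fin (sum f)
Σ-Fin {zero}  f = mk↔ₛ′ (λ { (() , _) }) (λ ()) (λ ()) (λ { (() , _) })
Σ-Fin {suc n} f = ↔-sym (+↔⊎ {f zero}) ↔-∘ (↔-id _ ⊎-↔ Σ-Fin (f ∘ suc)) ↔-∘ mk↔ₛ′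
  (λ { (zero , k) → inj₁ k ; (suc i , k) → inj₂ (i , k) })
  [ (zero ,_) , (λ (i , k) → suc i , k) ]′
  (λ { (inj₁ _) → refl ; (inj₂ _) → refl })
  (λ { (zero , _) → refl ; (suc _ , _) → refl })

Σ-assoc : ∀ {X : Set} {Y : X → Set} {Z : Σ X Y → Set} → Σ (Σ X Y) Z ↔ Σ X (λ x → Σ (Y x) (λ y → Z (x , y)))
Σ-assoc = mk↔ₛ′ (λ ((x , y) , z) → x , y , z) (λ (x , y , z) → (x , y) , z) (λ _ → refl) (λ _ → refl)

Fin-cong : ∀ {m n} → m ≡ n → Fin m ↔ Fin n
Fin-cong refl = ↔-id _

Σ-finite : ∀ {n} {X : Set} {B : X → Set} (e : X ↔ Fin n) (f : X → ℕ) → (∀ x → B x ↔ Fin (f x)) →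
           Σ X B ↔ Fin (sum (f ∘ Inverse.from e))
Σ-finite e f b = Σ-Fin (f ∘ Inverse.from e) ↔-∘
  Σ-↔ e (λ {x} → Fin-cong (cong f (sym (Inverse.strictlyInverseʳ e x))) ↔-∘ b x)

-- The weight `q` serves three purposes: constantly 1 it gives the finiteness of forests, and as the
-- indicator of ⟂ or of ⅋ it gives the two numbers that the correctness criterion compares.
count : (Label → ℕ) → Formula → ℕ
count q 𝟏       = q one
count q ⟂       = q bot
count q (A ⊗ B) = q tensor + (count q A + count q B)
count q (A ⅋ B) = q par + (count q A + count q B)

Pos-root : ∀ (q : Label → ℕ) A → Σ (Pos A) (Fin ∘ q ∘ labelAt) ↔
           (Fin (q (lab A)) ⊎ Σ (Fin (arity (lab A))) λ i → Σ (Pos (child A i)) (Fin ∘ q ∘ labelAt))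
Pos-root q A = mk↔ₛ′
  (λ { (root , k) → inj₁ k ; (sub i p , k) → inj₂ (i , p , k) })
  [ (root ,_) , (λ (i , p , k) → sub i p , k) ]′
  (λ { (inj₁ _) → refl ; (inj₂ _) → refl })
  (λ { (root , _) → refl ; (sub _ _ , _) → refl })

Σ-Fin₂ : ∀ {B : Fin 2 → Set} → Σ (Fin 2) B ↔ (B zero ⊎ B (suc zero))
Σ-Fin₂ = mk↔ₛ′
  (λ { (zero , b) → inj₁ b ; (suc zero , b) → inj₂ b })
  [ (zero ,_) , (suc zero ,_) ]′
  (λ { (inj₁ _) → refl ; (inj₂ _) → refl })
  (λ { (zero , _) → refl ; (suc zero , _) → refl })

⊎-Σ-Fin₀ : ∀ {X : Set} {B : Fin 0 → Set} → (X ⊎ Σ (Fin 0) B) ↔ X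
⊎-Σ-Fin₀ = mk↔ₛ′ (λ { (inj₁ x) → x ; (inj₂ (() , _)) }) inj₁ (λ _ → refl)
                 (λ { (inj₁ x) → refl ; (inj₂ (() , _)) })

Pos-count : ∀ q A → Σ (Pos A) (Fin ∘ q ∘ labelAt) ↔ Fin (count q A)
Pos-count q A@𝟏       = ⊎-Σ-Fin₀ ↔-∘ Pos-root q A
Pos-count q A@⟂       = ⊎-Σ-Fin₀ ↔-∘ Pos-root q A
Pos-count q A@(B ⊗ C) =
  ↔-sym (+↔⊎ {q tensor}) ↔-∘
  (↔-id _ ⊎-↔ (↔-sym (+↔⊎ {count q B}) ↔-∘ (Pos-count q B ⊎-↔ Pos-count q C) ↔-∘ Σ-Fin₂)) ↔-∘
  Pos-root q A
Pos-count q A@(B ⅋ C) =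
  ↔-sym (+↔⊎ {q par}) ↔-∘
  (↔-id _ ⊎-↔ (↔-sym (+↔⊎ {count q B}) ↔-∘ (Pos-count q B ⊎-↔ Pos-count q C) ↔-∘ Σ-Fin₂)) ↔-∘
  Pos-root q A

Pos-finite : ∀ A → Pos A ↔ Fin (count (const 1) A)
Pos-finite A = Pos-count (const 1) A ↔-∘
  mk↔ₛ′ (_, zero) proj₁ (λ { (_ , zero) → refl }) (λ _ → refl)

-- Forests of formula trees as proof-structures

record Forest : Set₁ where
  field
    Tree    : Set
    formula : Tree → Formula
    wf      : ∀ x → ICOMLL (formula x)
    size    : ℕ
    enum    : Tree ↔ Fin size

  Occ : Set
  Occ = Σ Tree (Pos ∘ formula)

  -- Relevant only at the occurrences of ⟂.
  field
    jumpTo : Occ → Occ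

module _ (F : Forest) {n : ℕ} (e : Forest.Tree F ↔ Fin n) where
  open Forest F

  -- An occurrence is both a cell and the conclusion of that cell, whence `tail = id`. The order of
  -- the conclusions is the parameter `e`, separate from the forest. All jumps go to cells, so the
  -- conditions of the ⅋ and ⊗ rules on the removed • nodes hold by construction.
  forestStructure : Structure n
  forestStructure = record
    { Cell       = Occ
    ; Arc        = Occ
    ; label      = λ (x , p) → labelAt p
    ; tail       = id
    ; head       = λ (x , p) → maybe′ (λ q → inj₁ (x , q)) (inj₂ (Inverse.to e x)) (parent p)
    ; premise    = λ (x , p) i → x , premiseAt p i
    ; conclusion = λ i → Inverse.from e i , root
    ; type       = λ (x , p) → at p
    ; jump       = λ c _ → just (inj₁ (jumpTo c))
    }

  private
    open Structure forestStructure using (Node; head; graph; _≺_)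

    head-cell : ∀ {x} (p : Pos (formula x)) {c} → head (x , p) ≡ inj₁ c →
                ∃ λ q → c ≡ (x , q) × parent p ≡ just q
    head-cell p h with parent p
    head-cell p refl | just q = q , refl , refl

    -- Arcs point towards the roots, so this number drops strictly along them, which excludes
    -- directed cycles. The shift by one leaves 0 to the • nodes.
    rank : Node → ℕ
    rank (inj₁ (x , p)) = suc (depth p)
    rank (inj₂ _)       = 0

    step-rank : ∀ x (p : Pos (formula x)) → rank (head (x , p)) < suc (depth p)
    step-rank x p with snoc p
    ... | root = s≤s z≤n
    ... | step {q} _ j rewrite parent-premiseAt q j | depth-premiseAt q j = n<1+n _

    path-rank : ∀ {u v} → u ≺ v → rank v < rank u
    path-rank [ (x , p) , refl , refl ]       = step-rank x p
    path-rank (((x , p) , refl , refl) ∷ path) = <-trans (path-rank path) (step-rank x p)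

    premise-unique : ∀ c a → head a ≡ inj₁ c → ∃! _≡_ λ i → (proj₁ c , premiseAt (proj₂ c) i) ≡ a
    premise-unique c (x , p) h with head-cell p h
    ... | q , refl , h′ with parent-just p h′
    ...   | j , refl = j , refl , λ eq → sym (premiseAt-injective q (occ-injective eq))
      where
      occ-injective : ∀ {x} {p q : Pos (formula x)} → _≡_ {A = Occ} (x , p) (x , q) → p ≡ q
      occ-injective refl = refl

    conclusion-only : ∀ i a → head a ≡ inj₂ i → (Inverse.from e i , root) ≡ a
    conclusion-only i (x , p) h with snoc p
    conclusion-only i (x , _) refl | root =
      cong (_, root) (Inverse.strictlyInverseʳ e x)
    conclusion-only i (x , _) h | step {q} _ j rewrite parent-premiseAt q j with h
    ... | ()

  forest : ProofStructure n
  forest = record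
    { structure        = forestStructure
    ; isProofStructure = record
      { cells-finite    = _ , Σ-finite e _ (Pos-finite ∘ formula)
      ; arcs-finite     = _ , Σ-finite e _ (Pos-finite ∘ formula)
      ; acyclic         = λ _ path → <-irrefl refl (path-rank path)
      ; one-conclusion  = λ c → c , refl , sym
      ; premise-head    = λ (x , p) i → cong (maybe′ _ _) (parent-premiseAt p i)
      ; premise-unique  = premise-unique
      ; conclusion-head = λ i → cong inj₂ (Inverse.strictlyInverseˡ e i)
      ; conclusion-only = conclusion-only
      ; typed           = λ (x , p) → trans (sym (conclusionType-child (at p)))
                            (conclusionType-cong (labelAt p) (λ i → sym (at-premiseAt p i)))
      ; icomll          = λ (x , p) → at-icomll p (wf x)
      }
    }

-- Isomorphisms of structures and the formulae of a derivable sequent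

Sum-map₁-∘ : ∀ {A B C D : Set} {f : A → B} {g : B → C} (x : A ⊎ D) →
             Sum.map₁ g (Sum.map₁ f x) ≡ Sum.map₁ (g ∘ f) x
Sum-map₁-∘ (inj₁ _) = refl
Sum-map₁-∘ (inj₂ _) = refl

toℕ-subst-arity : ∀ {ℓ ℓ′} (eq : ℓ ≡ ℓ′) (i : Fin (arity ℓ)) → toℕ (subst (Fin ∘ arity) eq i) ≡ toℕ i
toℕ-subst-arity refl i = refl

≅-trans : ∀ {n} {S T U : Structure n} → S ≅ T → T ≅ U → S ≅ U
≅-trans {S = S} f g = record
  { cells      = g.cells ↔-∘ f.cells
  ; arcs       = g.arcs ↔-∘ f.arcs
  ; label      = λ c → trans (g.label (f.cell c)) (f.label c)
  ; tail       = λ a → trans (g.tail (f.arc a)) (cong g.cell (f.tail a))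
  ; head       = λ a → trans (g.head (f.arc a)) (trans (cong g.node (f.head a)) (Sum-map₁-∘ (S.head a)))
  -- The middle structure needs an index of its own arity: `i` transported along the equation of
  -- labels, which keeps its value in ℕ.
  ; premise    = λ c i j eq →
      let ℓ = sym (f.label c)
      in trans (g.premise (f.cell c) (subst (Fin ∘ arity) ℓ i) j (trans (toℕ-subst-arity ℓ i) eq))
               (cong g.arc (f.premise c i _ (sym (toℕ-subst-arity ℓ i))))
  ; conclusion = λ i → trans (g.conclusion i) (cong g.arc (f.conclusion i))
  ; type       = λ a → trans (g.type (f.arc a)) (f.type a)
  ; jump       = λ c p q → trans (g.jump (f.cell c) (trans (f.label c) p) q)
                   (trans (cong (Maybe.map g.node) (f.jump c p (trans (f.label c) p)))
                          (map-node (S.jump c p)))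
  }
  where
  module S = Structure S
  module f = _≅_ f
  module g = _≅_ g
  map-node : ∀ m → Maybe.map g.node (Maybe.map f.node m) ≡ Maybe.map (Sum.map₁ (g.cell ∘ f.cell)) m
  map-node nothing  = refl
  map-node (just v) = cong just (Sum-map₁-∘ v)

-- Each constructor already ends with an isomorphism, and it is enough to compose with that one; no
-- induction is involved.
∣⇒-resp-≅ : ∀ {n} {Γ : Vec Formula n} {π : ⊢ Γ} {R R′} →
            ProofStructure.structure R′ ≅ ProofStructure.structure R → π ∣⇒ R → π ∣⇒ R′
∣⇒-resp-≅ f (one R g)            = one _ (≅-trans f g)
∣⇒-resp-≅ f (exchange d R g)     = exchange d _ (≅-trans f g)
∣⇒-resp-≅ f (bot d t R g)        = bot d t _ (≅-trans f g)
∣⇒-resp-≅ f (par d j R g)        = par d j _ (≅-trans f g)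
∣⇒-resp-≅ f (tensor d d′ j j′ R g) = tensor d d′ j j′ _ (≅-trans f g)

conclusionTypeOf : ∀ {n} → Structure n → Fin n → Formula
conclusionTypeOf S i = Structure.type S (Structure.conclusion S i)

≅-conclusionType : ∀ {n} {S T : Structure n} → S ≅ T → ∀ i →
                   conclusionTypeOf T i ≡ conclusionTypeOf S i
≅-conclusionType {S = S} {T} f i = trans (cong (Structure.type T) (_≅_.conclusion f i)) (_≅_.type f _)

lookup-exchange : ∀ {k l} (Γ : Vec Formula k) {A B} (Δ : Vec Formula l) i →
                  lookup (Γ ++ A ∷ B ∷ Δ) (transpose (k ↑ʳ zero) (k ↑ʳ suc zero) i) ≡
                  lookup (Γ ++ B ∷ A ∷ Δ) i
lookup-exchange []       Δ zero          = refl
lookup-exchange []       Δ (suc zero)    = refl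
lookup-exchange []       Δ (suc (suc i)) = refl
lookup-exchange (_ ∷ Γ)  Δ zero          = refl
lookup-exchange (C ∷ Γ)  Δ (suc i)       =
  trans (cong (lookup (C ∷ Γ ++ _ ∷ _ ∷ Δ)) (Perm.lift₀-transpose _ _ (suc i))) (lookup-exchange Γ Δ i)

-- Isomorphisms preserve the types of conclusions, so only the structure built by the last rule
-- matters. The rules below use this to know which formula they introduce.
∣⇒-type : ∀ {n} {Γ : Vec Formula n} {π : ⊢ Γ} {R} → π ∣⇒ R → ∀ i →
          lookup Γ i ≡ conclusionTypeOf (ProofStructure.structure R) i
∣⇒-type d i = trans (target d i) (≅-conclusionType (proj₂ (built d)) i)
  where
  built : ∀ {n} {Γ : Vec Formula n} {π : ⊢ Γ} {R} → π ∣⇒ R →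
          Σ (Structure n) (ProofStructure.structure R ≅_)
  built (one _ g)          = _ , g
  built (exchange _ _ g)   = _ , g
  built (bot _ _ _ g)      = _ , g
  built (par _ _ _ g)      = _ , g
  built (tensor _ _ _ _ _ g) = _ , g

  target : ∀ {n} {Γ : Vec Formula n} {π : ⊢ Γ} {R} (d : π ∣⇒ R) i →
           lookup Γ i ≡ conclusionTypeOf (proj₁ (built d)) i
  target (one _ _) zero = refl
  target (exchange {k} {Γ = Γ} {Δ = Δ} d _ _) i =
    trans (sym (lookup-exchange Γ Δ i)) (∣⇒-type d (transpose (k ↑ʳ zero) (k ↑ʳ suc zero) i))
  target (bot {k} {Γ} d _ _ _) i rewrite lookup-splitAt k Γ (⟂ ∷ []) i with splitAt k i
  ... | inj₁ j    = ∣⇒-type d j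
  ... | inj₂ zero = refl
  target (par {k} {Γ} {A} {B} d _ _ _) i rewrite lookup-splitAt k Γ (A ⅋ B ∷ []) i with splitAt k i
  ... | inj₁ j    = trans (sym (lookup-++ˡ Γ _ j)) (∣⇒-type d (j ↑ˡ 2))
  ... | inj₂ zero = cong₂ _⅋_
    (trans (sym (lookup-++ʳ Γ (A ∷ B ∷ []) zero)) (∣⇒-type d (k ↑ʳ zero)))
    (trans (sym (lookup-++ʳ Γ (A ∷ B ∷ []) (suc zero))) (∣⇒-type d (k ↑ʳ suc zero)))
  target (tensor {k} {l} {Γ} {A} {B} {Δ} d d′ _ _ _ _) i
    rewrite lookup-splitAt k Γ (A ⊗ B ∷ Δ) i with splitAt k i
  ... | inj₁ j       = trans (sym (lookup-++ˡ Γ _ j)) (∣⇒-type d (j ↑ˡ 1))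
  ... | inj₂ zero    = cong₂ _⊗_
    (trans (sym (lookup-++ʳ Γ (A ∷ []) zero)) (∣⇒-type d (k ↑ʳ zero))) (∣⇒-type d′ zero)
  ... | inj₂ (suc j) = ∣⇒-type d′ (suc j)

-- Relabelled forests and derivable proof-structures

Pos-cong : ∀ {A B} → A ≡ B → Pos A ↔ Pos B
Pos-cong refl = ↔-id _

cast : ∀ {A B} → A ≡ B → Pos A → Pos B
cast eq = Inverse.to (Pos-cong eq)

at-cast : ∀ {A B} (eq : A ≡ B) p → at (cast eq p) ≡ at p
at-cast refl p = refl

cast-root : ∀ {A B} (eq : A ≡ B) → cast eq root ≡ root
cast-root refl = refl

parent-cast : ∀ {A B} (eq : A ≡ B) p → parent (cast eq p) ≡ Maybe.map (cast eq) (parent p)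
parent-cast refl p with parent p
... | just _  = refl
... | nothing = refl

premiseAt-cast : ∀ {A B} (eq : A ≡ B) p i j → toℕ i ≡ toℕ j →
                 premiseAt (cast eq p) j ≡ cast eq (premiseAt p i)
premiseAt-cast refl p i j h = cong (premiseAt p) (toℕ-injective (sym h))

module _ (F G : Forest) (f : Forest.Tree F ↔ Forest.Tree G)
         (same : ∀ x → Forest.formula F x ≡ Forest.formula G (Inverse.to f x)) where
  private
    module F = Forest F
    module G = Forest G

  relabel : F.Occ ↔ G.Occ
  relabel = Σ-↔ f (λ {x} → Pos-cong (same x))

  forest-≅ : ∀ {n} (e : F.Tree ↔ Fin n) (e′ : G.Tree ↔ Fin n) →
             (∀ x → Inverse.to e′ (Inverse.to f x) ≡ Inverse.to e x) →
             (∀ c → G.jumpTo (Inverse.to relabel c) ≡ Inverse.to relabel (F.jumpTo c)) →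
             forestStructure F e ≅ forestStructure G e′
  forest-≅ e e′ ordered jumps = record
    { cells      = relabel
    ; arcs       = relabel
    ; label      = λ (x , p) → cong lab (at-cast (same x) p)
    ; tail       = λ _ → refl
    ; head       = λ (x , p) → head x p
    ; premise    = λ (x , p) i j h → cong (_ ,_) (premiseAt-cast (same x) p i j h)
    ; conclusion = conclusion
    ; type       = λ (x , p) → at-cast (same x) p
    ; jump       = λ c _ _ → cong (just ∘ inj₁) (jumps c)
    }
    where
    head : ∀ x p → Structure.head (forestStructure G e′) (Inverse.to relabel (x , p)) ≡
                   Sum.map₁ (Inverse.to relabel) (Structure.head (forestStructure F e) (x , p))
    head x p rewrite parent-cast (same x) p with parent p
    ... | just _  = refl
    ... | nothing = cong inj₂ (ordered x)

    conclusion : ∀ i → (Inverse.from e′ i , root) ≡ Inverse.to relabel (Inverse.from e i , root)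
    conclusion i rewrite cast-root (same (Inverse.from e i)) = cong (_, root)
      (trans (cong (Inverse.from e′) (sym (trans (ordered _) (Inverse.strictlyInverseˡ e i))))
             (Inverse.strictlyInverseʳ e′ _))

-- The sequent stays existential, so that no equations between concatenated vectors have to be
-- carried along; `∣⇒-type` recovers its formulae when they are needed.
Derivable : ∀ {n} → ProofStructure n → Set₁
Derivable {n} R = Σ (Vec Formula n) λ Γ → Σ (⊢ Γ) (_∣⇒ R)

Derivable-resp-≅ : ∀ {n} {R R′ : ProofStructure n} →
                   ProofStructure.structure R′ ≅ ProofStructure.structure R → Derivable R → Derivable R′
Derivable-resp-≅ f (_ , _ , d) = _ , _ , ∣⇒-resp-≅ f d

exchange-derivable : ∀ k l {R R₁ : ProofStructure (k + (2 + l))} →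
  ProofStructure.structure R ≅ exchangeStructure k l (ProofStructure.structure R₁) →
  Derivable R₁ → Derivable R
exchange-derivable k l f (Γ , π , d) with Vec.splitAt k Γ
... | Γ₁ , A ∷ B ∷ Δ , refl = _ , exchange Γ₁ A B Δ π , exchange d _ f

bot-derivable : ∀ k {R : ProofStructure (k + 1)} {R₁ : ProofStructure k} t →
  ProofStructure.structure R ≅ botStructure (ProofStructure.structure R₁) t →
  Derivable R₁ → Derivable R
bot-derivable k t f (Γ , π , d) = _ , bot Γ π , bot d t _ f

par-derivable : ∀ k {R : ProofStructure (k + 1)} {R₁ : ProofStructure (k + 2)} →
  ProofStructure.structure R ≅ parStructure k (ProofStructure.structure R₁) →
  (∀ i → NoJumpTo R₁ (k ↑ʳ i)) → Derivable R₁ → Derivable R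
par-derivable k {R} {R₁} f nj (Γ , π , d) with Vec.splitAt k Γ
... | Γ₁ , A ∷ B ∷ [] , refl = _ , par Γ₁ A B wf π , par d nj R f
  where
  active : ∀ i → lookup (A ∷ B ∷ []) i ≡ conclusionTypeOf (ProofStructure.structure R₁) (k ↑ʳ i)
  active i = trans (sym (lookup-++ʳ Γ₁ (A ∷ B ∷ []) i)) (∣⇒-type d (k ↑ʳ i))
  new : Structure.Arc (parStructure k (ProofStructure.structure R₁))
  new = inj₂ tt
  type-new : ProofStructure.type R (Inverse.from (_≅_.arcs f) new) ≡ A ⅋ B
  type-new = trans (sym (_≅_.type f _))
    (trans (cong (Structure.type (parStructure k (ProofStructure.structure R₁)))
                 (Inverse.strictlyInverseˡ (_≅_.arcs f) new))
           (sym (cong₂ _⅋_ (active zero) (active (suc zero)))))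
  -- The principal formula is the type of an arc of `R`, and all types of a proof-structure are in
  -- ICOMLL.
  wf : ICOMLL (A ⅋ B)
  wf = subst ICOMLL type-new (ProofStructure.icomll R _)

tensor-derivable : ∀ k l {R : ProofStructure (k + (1 + l))} {R₁ : ProofStructure (k + 1)} {R₂ : ProofStructure (1 + l)} →
  ProofStructure.structure R ≅ tensorStructure k l (ProofStructure.structure R₁) (ProofStructure.structure R₂) →
  NoJumpTo R₁ (k ↑ʳ zero) → NoJumpTo R₂ zero → Derivable R₁ → Derivable R₂ → Derivable R
tensor-derivable k l {R} {R₁} {R₂} f nj₁ nj₂ (Γ , π , d) (B ∷ Δ , π′ , d′) with Vec.splitAt k Γ
... | Γ₁ , A ∷ [] , refl = _ , tensor Γ₁ A B Δ wf π π′ , tensor d d′ nj₁ nj₂ R f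
  where
  S = tensorStructure k l (ProofStructure.structure R₁) (ProofStructure.structure R₂)
  new : Structure.Arc S
  new = inj₂ tt
  type-new : ProofStructure.type R (Inverse.from (_≅_.arcs f) new) ≡ A ⊗ B
  type-new = trans (sym (_≅_.type f _))
    (trans (cong (Structure.type S) (Inverse.strictlyInverseˡ (_≅_.arcs f) new))
           (sym (cong₂ _⊗_ (trans (sym (lookup-++ʳ Γ₁ (A ∷ []) zero)) (∣⇒-type d (k ↑ʳ zero)))
                           (∣⇒-type d′ zero))))
  wf : ICOMLL (A ⊗ B)
  wf = subst ICOMLL type-new (ProofStructure.icomll R _)

-- Reordering the conclusions by exchanges

transpose-left : ∀ {n} (i j : Fin n) → transpose i j i ≡ j
transpose-left i j with i ≟ i
... | yes _  = refl
... | no i≢i = ⊥-elim (i≢i refl)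

transpose-right : ∀ {n} (i j : Fin n) → transpose i j j ≡ i
transpose-right i j with j ≟ i
... | yes eq = eq
... | no _ with j ≟ j
...   | yes _  = refl
...   | no j≢j = ⊥-elim (j≢j refl)

transpose-other : ∀ {n} (i j : Fin n) {k} → k ≢ i → k ≢ j → transpose i j k ≡ k
transpose-other i j {k} k≢i k≢j with k ≟ i
... | yes eq = ⊥-elim (k≢i eq)
... | no _ with k ≟ j
...   | yes eq = ⊥-elim (k≢j eq)
...   | no _   = refl

transpose-same : ∀ {n} (i k : Fin n) → transpose i i k ≡ k
transpose-same i k with k ≟ i
... | yes eq = sym eq
... | no k≢i with k ≟ i
...   | yes eq = sym eq
...   | no _   = refl

transpose-comm : ∀ {n} (i j k : Fin n) → transpose i j k ≡ transpose j i k
transpose-comm i j k with k ≟ i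
... | yes refl = sym (transpose-right j k)
... | no k≢i with k ≟ j
...   | yes refl = refl
...   | no k≢j with k ≟ i
...     | yes eq = ⊥-elim (k≢i eq)
...     | no _   = refl

transpose-natural : ∀ {m n} (f : Fin m → Fin n) → (∀ {a b} → f a ≡ f b → a ≡ b) →
                    ∀ i j k → transpose (f i) (f j) (f k) ≡ f (transpose i j k)
transpose-natural f inj i j k with k ≟ i
... | yes refl = transpose-left (f k) (f j)
... | no k≢i with k ≟ j
...   | yes refl = transpose-right (f i) (f k)
...   | no k≢j   = transpose-other (f i) (f j) (k≢i ∘ inj) (k≢j ∘ inj)

-- Matching on this brings the length into the form `k + (2 + l)` that the exchange rule requires.
data Adjacent : ∀ {n} → Fin n → Fin n → Set where
  adjacent : ∀ k l → Adjacent {k + (2 + l)} (k ↑ʳ zero) (k ↑ʳ suc zero)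

adjacent? : ∀ {n} (i j : Fin n) → toℕ j ≡ suc (toℕ i) → Adjacent i j
adjacent? {suc (suc l)} zero (suc zero) eq = adjacent 0 l
adjacent? (suc i) (suc j) eq with adjacent? i j (ℕ.suc-injective eq)
... | adjacent k l = adjacent (suc k) l

record ForestDerivable (F : Forest) {n : ℕ} (e : Forest.Tree F ↔ Fin n) : Set₁ where
  constructor derivation
  field derivable : Derivable (forest F e)

module _ (F : Forest) where
  open Forest F

  private
    resp : ∀ {n} (e e′ : Tree ↔ Fin n) → (∀ x → Inverse.to e x ≡ Inverse.to e′ x) →
           ForestDerivable F e → ForestDerivable F e′
    resp e e′ h (derivation d) = derivation
      (Derivable-resp-≅ (forest-≅ F F (↔-id _) (λ _ → refl) e′ e h (λ _ → refl)) d)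

    exchange-≅ : ∀ k l (e : Tree ↔ Fin (k + (2 + l))) →
                 forestStructure F (Perm.transpose (k ↑ʳ zero) (k ↑ʳ suc zero) ↔-∘ e) ≅
                 exchangeStructure k l (forestStructure F e)
    exchange-≅ k l e = record
      { cells      = ↔-id _
      ; arcs       = ↔-id _
      ; label      = λ _ → refl
      ; tail       = λ _ → refl
      ; head       = λ (_ , p) → head p
      ; premise    = λ (x , p) i j h → cong (λ i → x , premiseAt p i) (toℕ-injective (sym h))
      -- The inverse of `Perm.transpose` has its two arguments swapped, whereas `exchangeStructure`
      -- applies the transposition itself.
      ; conclusion = λ i → cong (λ i → Inverse.from e i , root) (transpose-comm (k ↑ʳ zero) (k ↑ʳ suc zero) i)
      ; type       = λ _ → refl
      ; jump       = λ _ _ _ → refl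
      }
      where
      e′ = Perm.transpose (k ↑ʳ zero) (k ↑ʳ suc zero) ↔-∘ e
      S′ = exchangeStructure k l (forestStructure F e)
      head : ∀ {x} (p : Pos (formula x)) →
             Structure.head S′ (x , p) ≡ Sum.map₁ id (Structure.head (forestStructure F e′) (x , p))
      head p with parent p
      ... | just _  = refl
      ... | nothing = refl

    swap-adjacent : ∀ {n} {i j : Fin n} → Adjacent i j → ∀ e →
                    ForestDerivable F e → ForestDerivable F (Perm.transpose i j ↔-∘ e)
    swap-adjacent (adjacent k l) e (derivation d) =
      derivation (exchange-derivable k l (exchange-≅ k l e) d)

    -- With j and j - 1 exchanged before and after, the transposition of i and
    -- j - 1 becomes that of i and j.
    swap-distant : ∀ d {n} (i j : Fin n) → toℕ j ≡ d + suc (toℕ i) → ∀ e →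
                   ForestDerivable F e → ForestDerivable F (Perm.transpose i j ↔-∘ e)
    swap-distant zero    i j       eq e d = swap-adjacent (adjacent? i j eq) e d
    swap-distant (suc k) i (suc j) eq e d = resp (σ ↔-∘ (Perm.transpose i m ↔-∘ (σ ↔-∘ e))) _ pointwise
      (swap-adjacent adj _ (swap-distant k i m eq′ _ (swap-adjacent adj _ d)))
      where
      m   = inject₁ j
      σ   = Perm.transpose m (suc j)
      adj = adjacent? m (suc j) (cong suc (sym (toℕ-inject₁ j)))
      eq′ : toℕ m ≡ k + suc (toℕ i)
      eq′ = trans (toℕ-inject₁ j) (ℕ.suc-injective eq)
      i<m : toℕ i < toℕ m
      i<m = subst (toℕ i <_) (sym eq′) (ℕ.m≤n+m (suc (toℕ i)) k)
      i≢m : i ≢ m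
      i≢m i≡m = <-irrefl (cong toℕ i≡m) i<m
      i≢j : i ≢ suc j
      i≢j i≡j = <-irrefl (cong toℕ i≡j) (<-trans i<m (s≤s (ℕ.≤-reflexive (toℕ-inject₁ j))))
      τ = transpose m (suc j)
      τ-involutive : ∀ x → τ (τ x) ≡ x
      τ-involutive x = trans (transpose-comm m (suc j) (τ x)) (transpose-inverse (suc j) m)
      τ-injective : ∀ {a b} → τ a ≡ τ b → a ≡ b
      τ-injective {a} {b} h = trans (sym (τ-involutive a)) (trans (cong τ h) (τ-involutive b))
      pointwise : ∀ x → τ (transpose i m (τ (Inverse.to e x))) ≡ transpose i (suc j) (Inverse.to e x)
      pointwise x = begin
        τ (transpose i m (τ y))         ≡⟨ transpose-natural τ τ-injective i m (τ y) ⟨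
        transpose (τ i) (τ m) (τ (τ y)) ≡⟨ cong₂ (λ a b → transpose a b (τ (τ y)))
                                             (transpose-other m (suc j) i≢m i≢j) (transpose-left m (suc j)) ⟩
        transpose i (suc j) (τ (τ y))   ≡⟨ cong (transpose i (suc j)) (τ-involutive y) ⟩
        transpose i (suc j) y           ∎
        where
        open ≡-Reasoning
        y = Inverse.to e x

    swap-ordered : ∀ {n} (i j : Fin n) → toℕ i < toℕ j → ∀ e →
                   ForestDerivable F e → ForestDerivable F (Perm.transpose i j ↔-∘ e)
    swap-ordered i j i<j = swap-distant _ i j (sym (ℕ.m∸n+n≡m i<j))

    swap : ∀ {n} (i j : Fin n) e → ForestDerivable F e → ForestDerivable F (Perm.transpose i j ↔-∘ e)
    swap i j e d with ℕ.<-cmp (toℕ i) (toℕ j)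
    ... | tri< i<j _ _ = swap-ordered i j i<j e d
    ... | tri> _ _ j<i = resp (Perm.transpose j i ↔-∘ e) _ (λ x → transpose-comm j i (Inverse.to e x)) (swap-ordered j i j<i e d)
    ... | tri≈ _ i≡j _ with refl ← toℕ-injective i≡j =
      resp e _ (λ x → sym (transpose-same i (Inverse.to e x))) d

    swaps : ∀ {n} (xs : Transpositions.TranspositionList n) e → ForestDerivable F e →
            ForestDerivable F (Transpositions.eval xs ↔-∘ e)
    swaps []             e d = resp e _ (λ _ → refl) d
    swaps ((i , j) ∷ xs) e d = resp (Transpositions.eval xs ↔-∘ (Perm.transpose i j ↔-∘ e)) _ (λ _ → refl) (swaps xs _ (swap i j e d))

  -- A permutation is a product of transpositions, and each of these is a product of adjacent ones,
  -- that is, of exchange rules. The two lengths agree because both enumerate the same trees.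
  reorder : ∀ {m n} (e : Tree ↔ Fin m) (e′ : Tree ↔ Fin n) → ForestDerivable F e → ForestDerivable F e′
  reorder e e′ d with refl ← ↔⇒≡ (e′ ↔-∘ ↔-sym e) =
    resp (Transpositions.eval (Transpositions.decompose σ) ↔-∘ e) e′
         (λ x → trans (Transpositions.eval-decompose σ (Inverse.to e x))
                        (cong (Inverse.to e′) (Inverse.strictlyInverseʳ e x)))
         (swaps (Transpositions.decompose σ) e d)
    where
    σ : Permutation′ _
    σ = e′ ↔-∘ ↔-sym e

-- The sequent rules as operations on forests

ForestProvable : Forest → Set₁
ForestProvable F = ForestDerivable F (Forest.enum F)

-- The bijection `f` need not respect the two enumerations: `reorder` first gives `G` the order that
-- `F` induces through `f`.
ForestProvable-relabel : ∀ F G f same →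
  (∀ c → Forest.jumpTo G (Inverse.to (relabel F G f same) c) ≡
         Inverse.to (relabel F G f same) (Forest.jumpTo F c)) →
  ForestProvable G → ForestProvable F
ForestProvable-relabel F G f same jumps d
  with derivation d′ ← reorder G (Forest.enum G) (Forest.enum F ↔-∘ ↔-sym f) d =
  derivation (Derivable-resp-≅
    (forest-≅ F G f same (Forest.enum F) (Forest.enum F ↔-∘ ↔-sym f)
              (λ x → cong (Inverse.to (Forest.enum F)) (Inverse.strictlyInverseʳ f x)) jumps) d′)

∅ : Forest
∅ = record
  { Tree = ⊥ ; formula = λ () ; wf = λ () ; size = 0 ; enum = ↔-sym 0↔⊥ ; jumpTo = λ { (() , _) } }

module _ (F : Forest) where
  open Forest F

  AddOcc : Formula → Set
  AddOcc A = Σ (Tree ⊎ ⊤) (Pos ∘ [ formula , const A ]′)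

  old : ∀ {A} → Occ → AddOcc A
  old (x , p) = inj₁ x , p

  new : ∀ {A} → Pos A → AddOcc A
  new p = inj₂ tt , p

  -- The new tree comes last, which is where the ⟂ and ⅋ rules put their principal formula.
  add : ∀ A → ICOMLL A → (Pos A → AddOcc A) → Forest
  add A w j = record
    { Tree    = Tree ⊎ ⊤
    ; formula = [ formula , const A ]′
    ; wf      = λ { (inj₁ x) → wf x ; (inj₂ _) → w }
    ; size    = size + 1
    ; enum    = ↔-sym (+↔⊎ {size} {1}) ↔-∘ (enum ⊎-↔ ↔-sym 1↔⊤)
    ; jumpTo  = λ { (inj₁ x , p) → old (jumpTo (x , p)) ; (inj₂ _ , p) → j p }
    }

module _ (F G : Forest) where
  private
    module F = Forest F
    module G = Forest G

  union : Forest
  union = record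
    { Tree    = F.Tree ⊎ G.Tree
    ; formula = [ F.formula , G.formula ]′
    ; wf      = λ { (inj₁ x) → F.wf x ; (inj₂ y) → G.wf y }
    ; size    = F.size + G.size
    ; enum    = ↔-sym (+↔⊎ {F.size} {G.size}) ↔-∘ (F.enum ⊎-↔ G.enum)
    ; jumpTo  = λ { (inj₁ x , p) → let y , q = F.jumpTo (x , p) in inj₁ y , q
                  ; (inj₂ x , p) → let y , q = G.jumpTo (x , p) in inj₂ y , q }
    }

one-provable : ∀ w j → ForestProvable (add ∅ 𝟏 w j)
one-provable w j = derivation (_ , one , one _ record
  { cells      = occurrences
  ; arcs       = occurrences
  ; label      = λ { (inj₂ tt , root) → refl ; (inj₂ tt , sub () _) }
  ; tail       = λ _ → refl
  ; head       = λ { (inj₂ tt , root) → refl ; (inj₂ tt , sub () _) }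
  ; premise    = λ { (inj₂ tt , root) () ; (inj₂ tt , sub () _) }
  ; conclusion = λ _ → refl
  ; type       = λ { (inj₂ tt , root) → refl ; (inj₂ tt , sub () _) }
  ; jump       = λ _ _ ()
  })
  where
  occurrences : AddOcc ∅ 𝟏 ↔ ⊤
  occurrences = mk↔ₛ′ (const tt) (λ _ → new ∅ root) (λ _ → refl) (λ { (inj₂ tt , root) → refl ; (inj₂ tt , sub () _) })

module _ (F : Forest) (w : ICOMLL ⟂) (t : Forest.Occ F) where
  open Forest F
  private
    G = add F ⟂ w (λ _ → old F t)
    S = botStructure (forestStructure F enum) (inj₁ t)

  occurrences-⟂ : AddOcc F ⟂ ↔ (Occ ⊎ ⊤)
  occurrences-⟂ = mk↔ₛ′
    (λ { (inj₁ x , p) → inj₁ (x , p) ; (inj₂ tt , root) → inj₂ tt ; (inj₂ tt , sub () _) })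
    [ old F , (λ _ → new F root) ]′
    (λ { (inj₁ _) → refl ; (inj₂ _) → refl })
    (λ { (inj₁ _ , _) → refl ; (inj₂ tt , root) → refl ; (inj₂ tt , sub () _) })

  bot-≅ : forestStructure G (Forest.enum G) ≅ S
  bot-≅ = record
    { cells      = occurrences-⟂
    ; arcs       = occurrences-⟂
    ; label      = λ { (inj₁ _ , _) → refl ; (inj₂ tt , root) → refl ; (inj₂ tt , sub () _) }
    ; tail       = λ { (inj₁ _ , _) → refl ; (inj₂ tt , root) → refl ; (inj₂ tt , sub () _) }
    ; head       = λ { (inj₁ x , p) → head x p ; (inj₂ tt , root) → refl ; (inj₂ tt , sub () _) }
    ; premise    = λ { (inj₁ x , p) i j h → cong (λ i → inj₁ (x , premiseAt p i)) (toℕ-injective (sym h))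
                     ; (inj₂ tt , root) () ; (inj₂ tt , sub () _) }
    ; conclusion = conclusion
    ; type       = λ { (inj₁ _ , _) → refl ; (inj₂ tt , root) → refl ; (inj₂ tt , sub () _) }
    ; jump       = λ { (inj₁ _ , _) _ _ → refl ; (inj₂ tt , root) _ _ → refl ; (inj₂ tt , sub () _) }
    }
    where
    head : ∀ x p → Structure.head S (inj₁ (x , p)) ≡
                   Sum.map₁ (Inverse.to occurrences-⟂) (Structure.head (forestStructure G (Forest.enum G)) (inj₁ x , p))
    head x p with parent p
    ... | just _  = refl
    ... | nothing = refl
    conclusion : ∀ i → Structure.conclusion S i ≡
                       Inverse.to occurrences-⟂ (Structure.conclusion (forestStructure G (Forest.enum G)) i)
    conclusion i with splitAt size i
    ... | inj₁ _ = refl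
    ... | inj₂ _ = refl

  bot-provable : ForestProvable F → ForestProvable G
  bot-provable (derivation d) = derivation (bot-derivable size (inj₁ t) bot-≅ d)

module _ (F : Forest) {B C : Formula} (w : ICOMLL (B ⅋ C)) where
  open Forest F using (Tree; formula; wf; size; enum; jumpTo)

  AddTwoOcc : Set
  AddTwoOcc = Σ (Tree ⊎ Fin 2) (Pos ∘ [ formula , child (B ⅋ C) ]′)

  -- The premise of the ⅋ rule, with the two subtrees as separate trees. Indexing them by `Fin 2`
  -- makes the index of a tree equal to the premise number in `sub i`.
  addTwo : (∀ i → Pos (child (B ⅋ C) i) → AddTwoOcc) → Forest
  addTwo j = record
    { Tree    = Tree ⊎ Fin 2
    ; formula = [ formula , child (B ⅋ C) ]′
    ; wf      = λ { (inj₁ x) → wf x ; (inj₂ i) → child-icomll (B ⅋ C) i w }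
    ; size    = size + 2
    ; enum    = ↔-sym (+↔⊎ {size} {2}) ↔-∘ (enum ⊎-↔ ↔-id _)
    ; jumpTo  = λ { (inj₁ x , p) → let y , q = jumpTo (x , p) in inj₁ y , q ; (inj₂ i , p) → j i p }
    }

  embed-⅋ : AddTwoOcc → AddOcc F (B ⅋ C)
  embed-⅋ (inj₁ x , p) = old F (x , p)
  embed-⅋ (inj₂ i , p) = new F (sub i p)

  occurrences-⅋ : AddOcc F (B ⅋ C) ↔ (AddTwoOcc ⊎ ⊤)
  occurrences-⅋ = mk↔ₛ′
    (λ { (inj₁ x , p)      → inj₁ (inj₁ x , p)
       ; (inj₂ tt , root)    → inj₂ tt
       ; (inj₂ tt , sub i p) → inj₁ (inj₂ i , p) })
    [ embed-⅋ , (λ _ → new F root) ]′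
    (λ { (inj₁ (inj₁ _ , _)) → refl ; (inj₁ (inj₂ _ , _)) → refl ; (inj₂ tt) → refl })
    (λ { (inj₁ _ , _) → refl ; (inj₂ tt , root) → refl ; (inj₂ tt , sub _ _) → refl })

  module _ (j : ∀ i → Pos (child (B ⅋ C) i) → AddTwoOcc) (l : Pos (B ⅋ C) → AddOcc F (B ⅋ C))
           (jumps : ∀ i p → l (sub i p) ≡ embed-⅋ (j i p)) where
    private
      G = add F (B ⅋ C) w l
      H = addTwo j
      S = parStructure size (forestStructure H (Forest.enum H))
      T = forestStructure G (Forest.enum G)

    par-≅ : T ≅ S
    par-≅ = record
      { cells      = occurrences-⅋
      ; arcs       = occurrences-⅋
      ; label      = λ { (inj₁ _ , _) → refl ; (inj₂ tt , root) → refl ; (inj₂ tt , sub _ _) → refl }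
      ; tail       = λ { (inj₁ _ , _) → refl ; (inj₂ tt , root) → refl ; (inj₂ tt , sub _ _) → refl }
      ; head       = λ { (inj₁ x , p) → head-old x p ; (inj₂ tt , root) → refl
                       ; (inj₂ tt , sub i p) → head-new i p }
      ; premise    = premise
      ; conclusion = conclusion
      ; type       = type
      ; jump       = jump
      }
      where
      cell = Inverse.to occurrences-⅋

      head-old : ∀ x p → Structure.head S (cell (inj₁ x , p)) ≡
                         Sum.map₁ cell (Structure.head T (inj₁ x , p))
      head-old x p with parent p
      ... | just _  = refl
      ... | nothing rewrite splitAt-↑ˡ size (Inverse.to enum x) 2 = refl

      head-new : ∀ i p → Structure.head S (cell (inj₂ tt , sub i p)) ≡
                         Sum.map₁ cell (Structure.head T (inj₂ tt , sub i p))
      head-new i p with parent p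
      ... | just _  = refl
      ... | nothing rewrite splitAt-↑ʳ size 2 i = refl

      premise : ∀ c i i′ → toℕ i ≡ toℕ i′ →
                Structure.premise S (cell c) i′ ≡ cell (Structure.premise T c i)
      premise (inj₁ x , p)        i i′ h with refl ← toℕ-injective h = refl
      premise (inj₂ tt , sub i p) _ _  h with refl ← toℕ-injective h = refl
      premise (inj₂ tt , root)    i i′ h with refl ← toℕ-injective h
        rewrite splitAt-↑ʳ size 2 i = refl

      conclusion : ∀ i → Structure.conclusion S i ≡ cell (Structure.conclusion T i)
      conclusion i with splitAt size i
      ... | inj₁ i′   rewrite splitAt-↑ˡ size i′ 2 = refl
      ... | inj₂ zero = refl

      type : ∀ a → Structure.type S (cell a) ≡ Structure.type T a
      type (inj₁ _ , _)        = refl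
      type (inj₂ tt , sub _ _) = refl
      type (inj₂ tt , root) rewrite splitAt-↑ʳ size 2 zero | splitAt-↑ʳ size 2 (suc zero) = refl

      jump : ∀ c p q → Structure.jump S (cell c) q ≡ Maybe.map (Sum.map₁ cell) (Structure.jump T c p)
      jump (inj₁ x , p)        _ _ = refl
      jump (inj₂ tt , root)    () _
      jump (inj₂ tt , sub i p) _ _ = cong (just ∘ inj₁)
        (sym (trans (cong cell (jumps i p)) (Inverse.strictlyInverseˡ occurrences-⅋ (inj₁ (j i p)))))

    par-provable : ForestProvable H → ForestProvable G
    par-provable (derivation d) = derivation (par-derivable size par-≅ (λ _ _ _ ()) d)

module _ (F G : Forest) {B C : Formula} (wB : ICOMLL B) (wC : ICOMLL C) (w : ICOMLL (B ⊗ C)) where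
  private
    module F = Forest F
    module G = Forest G

  embed-⊗ˡ : AddOcc F B → AddOcc (union F G) (B ⊗ C)
  embed-⊗ˡ (inj₁ x , p)  = inj₁ (inj₁ x) , p
  embed-⊗ˡ (inj₂ tt , p) = inj₂ tt , sub zero p

  embed-⊗ʳ : AddOcc G C → AddOcc (union F G) (B ⊗ C)
  embed-⊗ʳ (inj₁ y , p)  = inj₁ (inj₂ y) , p
  embed-⊗ʳ (inj₂ tt , p) = inj₂ tt , sub (suc zero) p

  occurrences-⊗ : AddOcc (union F G) (B ⊗ C) ↔ ((AddOcc F B ⊎ AddOcc G C) ⊎ ⊤)
  occurrences-⊗ = mk↔ₛ′
    (λ { (inj₁ (inj₁ x) , p)          → inj₁ (inj₁ (inj₁ x , p))
       ; (inj₁ (inj₂ y) , p)          → inj₁ (inj₂ (inj₁ y , p))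
       ; (inj₂ tt , root)             → inj₂ tt
       ; (inj₂ tt , sub zero p)       → inj₁ (inj₁ (inj₂ tt , p))
       ; (inj₂ tt , sub (suc zero) p) → inj₁ (inj₂ (inj₂ tt , p)) })
    [ [ embed-⊗ˡ , embed-⊗ʳ ]′ , (λ _ → inj₂ tt , root) ]′
    (λ { (inj₁ (inj₁ (inj₁ _ , _)))  → refl
       ; (inj₁ (inj₁ (inj₂ tt , _))) → refl
       ; (inj₁ (inj₂ (inj₁ _ , _)))  → refl
       ; (inj₁ (inj₂ (inj₂ tt , _))) → refl
       ; (inj₂ tt)                   → refl })
    (λ { (inj₁ (inj₁ _) , _)          → refl
       ; (inj₁ (inj₂ _) , _)          → refl
       ; (inj₂ tt , root)             → refl
       ; (inj₂ tt , sub zero _)       → refl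
       ; (inj₂ tt , sub (suc zero) _) → refl })

  module _ (j : Pos B → AddOcc F B) (k : Pos C → AddOcc G C)
           (l : Pos (B ⊗ C) → AddOcc (union F G) (B ⊗ C))
           (jump-left  : ∀ p → l (sub zero p) ≡ embed-⊗ˡ (j p))
           (jump-right : ∀ p → l (sub (suc zero) p) ≡ embed-⊗ʳ (k p)) where
    private
      F′ = add F B wB j
      G′ = add G C wC k
      H  = add (union F G) (B ⊗ C) w l

      -- The ⊗ rule wants the active formula of its right premise in front, but `enum` puts it last;
      -- `reorder` goes from one order to the other.
      active-first : Forest.Tree G′ ↔ Fin (1 + G.size)
      active-first = mk↔ₛ′
        [ (λ y → suc (Inverse.to G.enum y)) , const zero ]′
        (λ { zero → inj₂ tt ; (suc i) → inj₁ (Inverse.from G.enum i) })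
        (λ { zero → refl ; (suc i) → cong suc (Inverse.strictlyInverseˡ G.enum i) })
        (λ { (inj₁ y) → cong inj₁ (Inverse.strictlyInverseʳ G.enum y) ; (inj₂ tt) → refl })

      active-middle : Forest.Tree H ↔ Fin (F.size + (1 + G.size))
      active-middle = ↔-sym (+↔⊎ {F.size} {1 + G.size}) ↔-∘ (F.enum ⊎-↔ active-first) ↔-∘ mk↔ₛ′
        Sum.assocʳ Sum.assocˡ
        (λ { (inj₁ _) → refl ; (inj₂ (inj₁ _)) → refl ; (inj₂ (inj₂ _)) → refl })
        (λ { (inj₁ (inj₁ _)) → refl ; (inj₁ (inj₂ _)) → refl ; (inj₂ _) → refl })

      S = tensorStructure F.size G.size (forestStructure F′ (Forest.enum F′)) (forestStructure G′ active-first)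
      T = forestStructure H active-middle

    tensor-≅ : T ≅ S
    tensor-≅ = record
      { cells      = occurrences-⊗
      ; arcs       = occurrences-⊗
      ; label      = λ { (inj₁ (inj₁ _) , _) → refl ; (inj₁ (inj₂ _) , _) → refl ; (inj₂ tt , root) → refl
                       ; (inj₂ tt , sub zero _) → refl ; (inj₂ tt , sub (suc zero) _) → refl }
      ; tail       = λ { (inj₁ (inj₁ _) , _) → refl ; (inj₁ (inj₂ _) , _) → refl ; (inj₂ tt , root) → refl
                       ; (inj₂ tt , sub zero _) → refl ; (inj₂ tt , sub (suc zero) _) → refl }
      ; head       = λ { (inj₁ (inj₁ x) , p) → head-oldˡ x p ; (inj₁ (inj₂ y) , p) → head-oldʳ y p
                       ; (inj₂ tt , root) → refl
                       ; (inj₂ tt , sub zero p) → head-left p ; (inj₂ tt , sub (suc zero) p) → head-right p }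
      ; premise    = premise
      ; conclusion = conclusion
      ; type       = type
      ; jump       = jump
      }
      where
      cell = Inverse.to occurrences-⊗

      head-oldˡ : ∀ x p → Structure.head S (cell (inj₁ (inj₁ x) , p)) ≡
                          Sum.map₁ cell (Structure.head T (inj₁ (inj₁ x) , p))
      head-oldˡ x p with parent p
      ... | just _  = refl
      ... | nothing rewrite splitAt-↑ˡ F.size (Inverse.to F.enum x) 1 = refl

      head-oldʳ : ∀ y p → Structure.head S (cell (inj₁ (inj₂ y) , p)) ≡
                          Sum.map₁ cell (Structure.head T (inj₁ (inj₂ y) , p))
      head-oldʳ y p with parent p
      ... | just _  = refl
      ... | nothing = refl

      head-left : ∀ p → Structure.head S (cell (inj₂ tt , sub zero p)) ≡
                        Sum.map₁ cell (Structure.head T (inj₂ tt , sub zero p))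
      head-left p with parent p
      ... | just _  = refl
      ... | nothing rewrite splitAt-↑ʳ F.size 1 zero = refl

      head-right : ∀ p → Structure.head S (cell (inj₂ tt , sub (suc zero) p)) ≡
                         Sum.map₁ cell (Structure.head T (inj₂ tt , sub (suc zero) p))
      head-right p with parent p
      ... | just _  = refl
      ... | nothing = refl

      premise : ∀ c i i′ → toℕ i ≡ toℕ i′ →
                Structure.premise S (cell c) i′ ≡ cell (Structure.premise T c i)
      premise (inj₁ (inj₁ x) , p)          i i′ h with refl ← toℕ-injective h = refl
      premise (inj₁ (inj₂ y) , p)          i i′ h with refl ← toℕ-injective h = refl
      premise (inj₂ tt , sub zero p)       i i′ h with refl ← toℕ-injective h = refl
      premise (inj₂ tt , sub (suc zero) p) i i′ h with refl ← toℕ-injective h = refl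
      premise (inj₂ tt , root) zero       zero       h rewrite splitAt-↑ʳ F.size 1 zero = refl
      premise (inj₂ tt , root) (suc zero) (suc zero) h = refl

      conclusion : ∀ i → Structure.conclusion S i ≡ cell (Structure.conclusion T i)
      conclusion i with splitAt F.size i
      ... | inj₁ i′      rewrite splitAt-↑ˡ F.size i′ 1 = refl
      ... | inj₂ zero    = refl
      ... | inj₂ (suc _) = refl

      type : ∀ a → Structure.type S (cell a) ≡ Structure.type T a
      type (inj₁ (inj₁ _) , _)          = refl
      type (inj₁ (inj₂ _) , _)          = refl
      type (inj₂ tt , sub zero _)       = refl
      type (inj₂ tt , sub (suc zero) _) = refl
      type (inj₂ tt , root) rewrite splitAt-↑ʳ F.size 1 zero = refl

      jump : ∀ c p q → Structure.jump S (cell c) q ≡ Maybe.map (Sum.map₁ cell) (Structure.jump T c p)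
      jump (inj₁ (inj₁ x) , p)          _ _ = refl
      jump (inj₁ (inj₂ y) , p)          _ _ = refl
      jump (inj₂ tt , root)             () _
      jump (inj₂ tt , sub zero p)       _ _ = cong (just ∘ inj₁)
        (sym (trans (cong cell (jump-left p)) (Inverse.strictlyInverseˡ occurrences-⊗ (inj₁ (inj₁ (j p))))))
      jump (inj₂ tt , sub (suc zero) p) _ _ = cong (just ∘ inj₁)
        (sym (trans (cong cell (jump-right p)) (Inverse.strictlyInverseˡ occurrences-⊗ (inj₁ (inj₂ (k p))))))

    tensor-provable : ForestProvable F′ → ForestProvable G′ → ForestProvable H
    tensor-provable (derivation d) d′ with derivation d″ ← reorder G′ (Forest.enum G′) active-first d′ =
      reorder H active-middle (Forest.enum H) (derivation
        (tensor-derivable F.size G.size tensor-≅ (λ _ _ ()) (λ _ _ ()) d d″))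

-- Canonical jumps on positions and the derivations of single trees

-- The occurrence of m_⊗, for m the root.
tensorPos : ∀ {A} → Output A → Pos A
tensorPos 𝟏         = root
tensorPos (O⊗O _ _) = root
tensorPos (O⅋I a _) = sub zero (tensorPos a)
tensorPos (I⅋O _ b) = sub (suc zero) (tensorPos b)

-- The canonical jump of an occurrence of ⟂ (junk at other occurrences).  In an
-- input formula it is nothing when no output ⅋ of the formula lies below.

mutual
  jumpO : ∀ {A} → Output A → Pos A → Pos A
  jumpO _         root               = root
  jumpO (O⊗O a b) (sub zero p)       = sub zero (jumpO a p)
  jumpO (O⊗O a b) (sub (suc zero) p) = sub (suc zero) (jumpO b p)
  jumpO (O⅋I a b) (sub zero p)       = sub zero (jumpO a p)
  jumpO (O⅋I a b) (sub (suc zero) p) = maybe′ (sub (suc zero)) (sub zero (tensorPos a)) (jumpI b p)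
  jumpO (I⅋O a b) (sub zero p)       = maybe′ (sub zero) (sub (suc zero) (tensorPos b)) (jumpI a p)
  jumpO (I⅋O a b) (sub (suc zero) p) = sub (suc zero) (jumpO b p)

  jumpI : ∀ {A} → Input A → Pos A → Maybe (Pos A)
  jumpI ⟂         _                  = nothing
  jumpI (I⅋I a b) root               = nothing
  jumpI (I⅋I a b) (sub zero p)       = Maybe.map (sub zero) (jumpI a p)
  jumpI (I⅋I a b) (sub (suc zero) p) = Maybe.map (sub (suc zero)) (jumpI b p)
  jumpI (I⊗O a b) root               = nothing
  jumpI (I⊗O a b) (sub zero p)       = Maybe.map (sub zero) (jumpI a p)
  jumpI (I⊗O a b) (sub (suc zero) p) = just (sub (suc zero) (jumpO b p))
  jumpI (O⊗I a b) root               = nothing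
  jumpI (O⊗I a b) (sub zero p)       = just (sub zero (jumpO a p))
  jumpI (O⊗I a b) (sub (suc zero) p) = Maybe.map (sub (suc zero)) (jumpI b p)

outputForest : ∀ {A} → Output A → Forest
outputForest a = add ∅ _ (inj₁ a) (new ∅ ∘ jumpO a)

-- The target `t` of the jumps that leave the tree lies in `F`, hence in a structure that is derived
-- before any ⟂ of the new tree.
addInput : ∀ F {A} → Input A → Forest.Occ F → Forest
addInput F a t = add F _ (inj₂ a) (maybe′ (new F) (old F t) ∘ jumpI a)

maybe′-map : ∀ {A B C : Set} {f : B → C} {c} {g : A → B} {h : A → C} (m : Maybe A) →
             (∀ a → f (g a) ≡ h a) → maybe′ f c (Maybe.map g m) ≡ maybe′ h c m
maybe′-map nothing  eq = refl
maybe′-map (just a) eq = eq a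

maybe′-natural : ∀ {A B C : Set} (f : B → C) {g : A → B} {b} (m : Maybe A) →
                 f (maybe′ g b m) ≡ maybe′ (f ∘ g) (f b) m
maybe′-natural f nothing  = refl
maybe′-natural f (just _) = refl

module _ (X : Set) where
  left-then-right : (X ⊎ Fin 2) ↔ ((X ⊎ ⊤) ⊎ ⊤)
  left-then-right = mk↔ₛ′
    (λ { (inj₁ x) → inj₁ (inj₁ x) ; (inj₂ zero) → inj₁ (inj₂ tt) ; (inj₂ (suc zero)) → inj₂ tt })
    (λ { (inj₁ (inj₁ x)) → inj₁ x ; (inj₁ (inj₂ tt)) → inj₂ zero ; (inj₂ tt) → inj₂ (suc zero) })
    (λ { (inj₁ (inj₁ _)) → refl ; (inj₁ (inj₂ _)) → refl ; (inj₂ _) → refl })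
    (λ { (inj₁ _) → refl ; (inj₂ zero) → refl ; (inj₂ (suc zero)) → refl })

  -- For I ⅋ O the output is derived first, since ⟂ of the input jump into it; the trees are then
  -- added in the order opposite to that of the premises.
  right-then-left : (X ⊎ Fin 2) ↔ ((X ⊎ ⊤) ⊎ ⊤)
  right-then-left = mk↔ₛ′
    (λ { (inj₁ x) → inj₁ (inj₁ x) ; (inj₂ (suc zero)) → inj₁ (inj₂ tt) ; (inj₂ zero) → inj₂ tt })
    (λ { (inj₁ (inj₁ x)) → inj₁ x ; (inj₁ (inj₂ tt)) → inj₂ (suc zero) ; (inj₂ tt) → inj₂ zero })
    (λ { (inj₁ (inj₁ _)) → refl ; (inj₁ (inj₂ _)) → refl ; (inj₂ _) → refl })
    (λ { (inj₁ _) → refl ; (inj₂ zero) → refl ; (inj₂ (suc zero)) → refl })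

  -- A premise of the ⊗ rule that derives a lone output formula contributes the empty forest as
  -- context, which has to be absorbed afterwards.
  emptyʳ : (X ⊎ ⊤) ↔ ((X ⊎ ⊥) ⊎ ⊤)
  emptyʳ = mk↔ₛ′ (Sum.map₁ inj₁) (λ { (inj₁ (inj₁ x)) → inj₁ x ; (inj₁ (inj₂ ())) ; (inj₂ _) → inj₂ tt })
    (λ { (inj₁ (inj₁ _)) → refl ; (inj₁ (inj₂ ())) ; (inj₂ _) → refl }) (λ { (inj₁ _) → refl ; (inj₂ _) → refl })

  emptyˡ : (X ⊎ ⊤) ↔ ((⊥ ⊎ X) ⊎ ⊤)
  emptyˡ = mk↔ₛ′ (Sum.map₁ inj₂) (λ { (inj₁ (inj₁ ())) ; (inj₁ (inj₂ x)) → inj₁ x ; (inj₂ _) → inj₂ tt })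
    (λ { (inj₁ (inj₁ ())) ; (inj₁ (inj₂ _)) → refl ; (inj₂ _) → refl }) (λ { (inj₁ _) → refl ; (inj₂ _) → refl })

module _ {X : Set} (A : X → Formula) (B C : Formula) where
  left-then-right-formula : ∀ x → [ A , child (B ⅋ C) ]′ x ≡
    [ [ A , const B ]′ , const C ]′ (Inverse.to (left-then-right X) x)
  left-then-right-formula (inj₁ _)          = refl
  left-then-right-formula (inj₂ zero)       = refl
  left-then-right-formula (inj₂ (suc zero)) = refl

  right-then-left-formula : ∀ x → [ A , child (B ⅋ C) ]′ x ≡
    [ [ A , const C ]′ , const B ]′ (Inverse.to (right-then-left X) x)
  right-then-left-formula (inj₁ _)          = refl
  right-then-left-formula (inj₂ zero)       = refl
  right-then-left-formula (inj₂ (suc zero)) = refl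

module _ (F : Forest) (B : Formula) where
  open Forest F using (Tree; formula)

  emptyʳ-formula : ∀ x → [ formula , const B ]′ x ≡
    [ [ formula , Forest.formula ∅ ]′ , const B ]′ (Inverse.to (emptyʳ Tree) x)
  emptyʳ-formula (inj₁ _) = refl
  emptyʳ-formula (inj₂ _) = refl

  emptyˡ-formula : ∀ x → [ formula , const B ]′ x ≡
    [ [ Forest.formula ∅ , formula ]′ , const B ]′ (Inverse.to (emptyˡ Tree) x)
  emptyˡ-formula (inj₁ _) = refl
  emptyˡ-formula (inj₂ _) = refl

mutual
  output-provable : ∀ {A} (a : Output A) → ForestProvable (outputForest a)
  output-provable 𝟏 = one-provable _ _
  output-provable {A} (O⊗O a b) = ForestProvable-relabel (outputForest (O⊗O a b))
    (add (union ∅ ∅) A (inj₁ (O⊗O a b)) l) (emptyʳ ⊥)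
    (emptyʳ-formula ∅ A) (λ { (inj₂ _ , _) → refl })
    (tensor-provable ∅ ∅ (inj₁ a) (inj₁ b) (inj₁ (O⊗O a b)) _ _ l (λ _ → refl) (λ _ → refl)
       (output-provable a) (output-provable b))
    where
    l : Pos A → AddOcc (union ∅ ∅) A
    l p = inj₂ tt , jumpO (O⊗O a b) p
  output-provable {A} (O⅋I a b) = par-provable ∅ w j _
    (λ { zero       p → refl
       ; (suc zero) p → sym (trans (maybe′-natural (embed-⅋ ∅ w) (jumpI b p))
                                   (sym (maybe′-natural (new ∅) (jumpI b p)))) })
    (ForestProvable-relabel (addTwo ∅ w j) (addInput (outputForest a) b t) (left-then-right ⊥)
       (left-then-right-formula (Forest.formula ∅) _ _)
       (λ { (inj₂ zero , p) → refl
          ; (inj₂ (suc zero) , p) → sym (maybe′-natural (Inverse.to (relabel (addTwo ∅ w j) (addInput (outputForest a) b t) (left-then-right ⊥) (left-then-right-formula (Forest.formula ∅) _ _))) (jumpI b p)) })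
       (input-provable (outputForest a) b t (output-provable a)))
    where
    w = inj₁ (O⅋I a b)
    -- The node m_⊗ of the ⅋ to be built is that of its output premise, so it is available before
    -- the ⅋ is.
    t = new ∅ (tensorPos a)
    j : ∀ i → Pos (child A i) → AddTwoOcc ∅ w
    j zero       p = inj₂ zero , jumpO a p
    j (suc zero) p = maybe′ (inj₂ (suc zero) ,_) (inj₂ zero , tensorPos a) (jumpI b p)
  output-provable {A} (I⅋O a b) = par-provable ∅ w j _
    (λ { (suc zero) p → refl
       ; zero       p → sym (trans (maybe′-natural (embed-⅋ ∅ w) (jumpI a p))
                                   (sym (maybe′-natural (new ∅) (jumpI a p)))) })
    (ForestProvable-relabel (addTwo ∅ w j) (addInput (outputForest b) a t) (right-then-left ⊥)
       (right-then-left-formula (Forest.formula ∅) _ _)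
       (λ { (inj₂ (suc zero) , p) → refl
          ; (inj₂ zero , p) → sym (maybe′-natural (Inverse.to (relabel (addTwo ∅ w j) (addInput (outputForest b) a t) (right-then-left ⊥) (right-then-left-formula (Forest.formula ∅) _ _))) (jumpI a p)) })
       (input-provable (outputForest b) a t (output-provable b)))
    where
    w = inj₁ (I⅋O a b)
    t = new ∅ (tensorPos b)
    j : ∀ i → Pos (child A i) → AddTwoOcc ∅ w
    j (suc zero) p = inj₂ (suc zero) , jumpO b p
    j zero       p = maybe′ (inj₂ zero ,_) (inj₂ (suc zero) , tensorPos b) (jumpI a p)

  input-provable : ∀ F {A} (a : Input A) t → ForestProvable F → ForestProvable (addInput F a t)
  input-provable F ⟂ t d = bot-provable F _ t d
  input-provable F {A} (I⅋I a b) t d = par-provable F w j _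
    (λ { zero       p → trans (maybe′-map (jumpI a p) (λ _ → refl)) (sym (maybe′-natural (embed-⅋ F w) (jumpI a p)))
       ; (suc zero) p → trans (maybe′-map (jumpI b p) (λ _ → refl)) (sym (maybe′-natural (embed-⅋ F w) (jumpI b p))) })
    (ForestProvable-relabel (addTwo F w j) (addInput (addInput F a t) b (old F t)) (left-then-right _)
       (left-then-right-formula (Forest.formula F) _ _)
       (λ { (inj₁ _ , _) → refl
          ; (inj₂ zero , p) → trans (maybe′-natural (old (addInput F a t)) (jumpI a p)) (sym (maybe′-natural (Inverse.to (relabel (addTwo F w j) (addInput (addInput F a t) b (old F t)) (left-then-right _) (left-then-right-formula (Forest.formula F) _ _))) (jumpI a p)))
          ; (inj₂ (suc zero) , p) → sym (maybe′-natural (Inverse.to (relabel (addTwo F w j) (addInput (addInput F a t) b (old F t)) (left-then-right _) (left-then-right-formula (Forest.formula F) _ _))) (jumpI b p)) })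
       -- An input ⅋ stops no jump, so both parts keep the same external target.
       (input-provable (addInput F a t) b (old F t) (input-provable F a t d)))
    where
    w = inj₂ (I⅋I a b)
    t₂ : AddTwoOcc F w
    t₂ = inj₁ (proj₁ t) , proj₂ t
    j : ∀ i → Pos (child A i) → AddTwoOcc F w
    j zero       p = maybe′ (inj₂ zero ,_) t₂ (jumpI a p)
    j (suc zero) p = maybe′ (inj₂ (suc zero) ,_) t₂ (jumpI b p)
  input-provable F {A} (I⊗O a b) t d = ForestProvable-relabel (addInput F c t)
    (addInput (union F ∅) c (inj₁ (proj₁ t) , proj₂ t)) (emptyʳ _)
    (emptyʳ-formula F A)
    (λ { (inj₁ _ , _) → refl ; (inj₂ _ , p) → sym (maybe′-natural (Inverse.to (relabel (addInput F c t) (addInput (union F ∅) c (inj₁ (proj₁ t) , proj₂ t)) (emptyʳ _) (emptyʳ-formula F A))) (jumpI c p)) })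
    (tensor-provable F ∅ (inj₂ a) (inj₁ b) (inj₂ c) _ _ _
       (λ p → trans (maybe′-map (jumpI a p) (λ _ → refl))
                    (sym (maybe′-natural (embed-⊗ˡ F ∅ (inj₂ a) (inj₁ b) (inj₂ c)) (jumpI a p))))
       (λ _ → refl)
       -- The jumps of the output part are internal to it, so the whole context `F` and the target
       -- `t` go with the input part.
       (input-provable F a t d) (output-provable b))
    where c = I⊗O a b
  input-provable F {A} (O⊗I a b) t d = ForestProvable-relabel (addInput F c t)
    (addInput (union ∅ F) c (inj₂ (proj₁ t) , proj₂ t)) (emptyˡ _)
    (emptyˡ-formula F A)
    (λ { (inj₁ _ , _) → refl ; (inj₂ _ , p) → sym (maybe′-natural (Inverse.to (relabel (addInput F c t) (addInput (union ∅ F) c (inj₂ (proj₁ t) , proj₂ t)) (emptyˡ _) (emptyˡ-formula F A))) (jumpI c p)) })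
    (tensor-provable ∅ F (inj₁ a) (inj₂ b) (inj₂ c) _ _ _
       (λ _ → refl)
       (λ p → trans (maybe′-map (jumpI b p) (λ _ → refl))
                    (sym (maybe′-natural (embed-⊗ʳ ∅ F (inj₁ a) (inj₂ b) (inj₂ c)) (jumpI b p))))
       (output-provable a) (input-provable F b t d))
    where c = O⊗I a b

-- The arcs of a proof-structure as the occurrences in its conclusions

lab-conclusionType : ∀ ℓ f → lab (conclusionType ℓ f) ≡ ℓ
lab-conclusionType one    f = refl
lab-conclusionType bot    f = refl
lab-conclusionType tensor f = refl
lab-conclusionType par    f = refl

child-conclusionType : ∀ {A ℓ f} → A ≡ conclusionType ℓ f → (eq : lab A ≡ ℓ) → ∀ i →
                       f (subst (Fin ∘ arity) eq i) ≡ child A i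
child-conclusionType {ℓ = tensor} refl refl zero       = refl
child-conclusionType {ℓ = tensor} refl refl (suc zero) = refl
child-conclusionType {ℓ = par}    refl refl zero       = refl
child-conclusionType {ℓ = par}    refl refl (suc zero) = refl

module _ {n : ℕ} (R : ProofStructure n) where
  open ProofStructure R

  lab-type : ∀ {A} a → type a ≡ A → lab A ≡ label (tail a)
  lab-type a refl = trans (cong lab (typed a)) (lab-conclusionType _ _)

  branch : ∀ {A} a → type a ≡ A → Fin (arity (lab A)) → Arc
  branch a eq i = premise (tail a) (subst (Fin ∘ arity) (lab-type a eq) i)

  type-branch : ∀ {A} a (eq : type a ≡ A) i → type (branch a eq i) ≡ child A i
  type-branch a eq i = child-conclusionType (trans (sym eq) (typed a)) (lab-type a eq) i

  -- Without axioms the arcs above a given one form the tree of its type.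
  arcAt : ∀ {A} a → type a ≡ A → Pos A → Arc
  arcAt a eq root      = a
  arcAt a eq (sub i p) = arcAt (branch a eq i) (type-branch a eq i) p

  type-arcAt : ∀ {A} a (eq : type a ≡ A) p → type (arcAt a eq p) ≡ at p
  type-arcAt a eq root      = eq
  type-arcAt a eq (sub i p) = type-arcAt (branch a eq i) (type-branch a eq i) p

  -- `arcAt` recurses from the root, whereas the laws of proof-structures concern the last premise
  -- of a path; this passes from one view to the other.
  arcAt-premiseAt : ∀ {A} a (eq : type a ≡ A) p i j → toℕ i ≡ toℕ j →
                    arcAt a eq (premiseAt p i) ≡ premise (tail (arcAt a eq p)) j
  arcAt-premiseAt a eq root      i j h = cong (premise (tail a))
    (toℕ-injective (trans (toℕ-subst-arity (lab-type a eq) i) h))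
  arcAt-premiseAt a eq (sub k p) i j h = arcAt-premiseAt (branch a eq k) (type-branch a eq k) p i j h

  module _ {X : Set} (A : X → Formula) (e : X ↔ Fin n)
           (same : ∀ x → type (conclusion (Inverse.to e x)) ≡ A x) where
    private
      Occ : Set
      Occ = Σ X (Pos ∘ A)

    -- The index set is left general: it is `Fin n` when cells are counted, and the set of trees of
    -- `canonicalForest` in the final comparison.
    arcOf : Occ → Arc
    arcOf (x , p) = arcAt (conclusion (Inverse.to e x)) (same x) p

    type-arcOf : ∀ c → type (arcOf c) ≡ at (proj₂ c)
    type-arcOf (x , p) = type-arcAt _ (same x) p

    label-arcOf : ∀ c → labelAt (proj₂ c) ≡ label (tail (arcOf c))
    label-arcOf c = lab-type (arcOf c) (type-arcOf c)

    premise-arcOf : ∀ x p i j → toℕ i ≡ toℕ j → arcOf (x , premiseAt p i) ≡ premise (tail (arcOf (x , p))) j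
    premise-arcOf x p = arcAt-premiseAt _ (same x) p

    private
      branchOf : ∀ c → Fin (arity (labelAt (proj₂ c))) → Fin (arity (label (tail (arcOf c))))
      branchOf c = subst (Fin ∘ arity) (label-arcOf c)

      premise-branchOf : ∀ x p i → arcOf (x , premiseAt p i) ≡ premise (tail (arcOf (x , p))) (branchOf (x , p) i)
      premise-branchOf x p i = premise-arcOf x p i _ (sym (toℕ-subst-arity (label-arcOf (x , p)) i))

    head-arcOf : ∀ x p → head (arcOf (x , p)) ≡
                 maybe′ (λ q → inj₁ (tail (arcOf (x , q)))) (inj₂ (Inverse.to e x)) (parent p)
    head-arcOf x p with snoc p
    ... | root = conclusion-head _
    ... | step {q} _ i rewrite parent-premiseAt q i =
      trans (cong head (premise-branchOf x q i)) (premise-head _ _)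

    private
      tail-injective : ∀ {a b} → tail a ≡ tail b → a ≡ b
      tail-injective {a} {b} eq =
        trans (sym (conclusionOf-tail R a)) (trans (cong conclusionOf eq) (conclusionOf-tail R b))

      premise-injective : ∀ c {i j} → premise c i ≡ premise c j → i ≡ j
      premise-injective c {i} {j} eq with premise-unique c (premise c i) (premise-head c i)
      ... | _ , _ , unique = trans (sym (unique refl)) (unique (sym eq))

      head-step : ∀ x p i → head (arcOf (x , premiseAt p i)) ≡ inj₁ (tail (arcOf (x , p)))
      head-step x p i = trans (head-arcOf x (premiseAt p i)) (cong (maybe′ _ _) (parent-premiseAt p i))

      -- Equal arcs have equal heads. A head that is a • node determines the conclusion; a head that
      -- is a cell determines the parent by induction, and then the last premise number.
      injective : ∀ {x y p q} → Snoc p → Snoc q → arcOf (x , p) ≡ arcOf (y , q) →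
                  _≡_ {A = Occ} (x , p) (y , q)
      injective {x} {y} root root eq
        with refl ← trans (sym (Inverse.strictlyInverseʳ e x)) (trans (cong (Inverse.from e)
               (inj₂-injective (trans (sym (conclusion-head _)) (trans (cong head eq) (conclusion-head _)))))
               (Inverse.strictlyInverseʳ e y)) = refl
      injective {x} {y} root (step {q} _ j) eq
        with () ← trans (sym (conclusion-head (Inverse.to e x))) (trans (cong head eq) (head-step y q j))
      injective {x} {y} (step {p} _ i) root eq
        with () ← trans (sym (head-step x p i)) (trans (cong head eq) (conclusion-head (Inverse.to e y)))
      injective {x} {y} (step {p} s i) (step {q} t j) eq
        with refl ← injective s t (tail-injective
               (inj₁-injective (trans (sym (head-step x p i)) (trans (cong head eq) (head-step y q j))))) =
        cong (λ i → x , premiseAt p i) (toℕ-injective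
          (trans (sym (toℕ-subst-arity (label-arcOf (x , p)) i))
          (trans (cong toℕ (premise-injective _
                   (trans (sym (premise-branchOf x p i)) (trans eq (premise-branchOf x p j)))))
                 (toℕ-subst-arity (label-arcOf (x , p)) j))))

      -- Following conclusions downwards reaches a • node, as ≺ is well founded in that direction;
      -- on the way back the occurrence grows by one premise per step.
      surjective : ∀ c → Acc (flip λ c d → inj₁ c ≺ inj₁ d) c → ∃ λ o → arcOf o ≡ conclusionOf c
      surjective c (acc rs) with head (conclusionOf c) in h
      ... | inj₂ i = (Inverse.from e i , root) ,
        trans (cong conclusion (Inverse.strictlyInverseˡ e i)) (conclusion-only i _ h)
      ... | inj₁ d with surjective d (rs [ conclusionOf c , cong inj₁ (tail-conclusionOf R c) , h ])
      ...   | (x , p) , eq with refl ← trans (sym (tail-conclusionOf R d)) (cong tail (sym eq))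
                           with premise-unique _ _ h
      ...     | j , premise≡ , _ = (x , premiseAt p (subst (Fin ∘ arity) (sym (label-arcOf (x , p))) j)) ,
        trans (premise-arcOf x p _ j (toℕ-subst-arity (sym (label-arcOf (x , p))) j)) premise≡

      arcOf⁻¹ : ∀ a → ∃ λ o → arcOf o ≡ a
      arcOf⁻¹ a with surjective (tail a) (≻-wellFounded R (tail a))
      ... | o , eq = o , trans eq (conclusionOf-tail R a)

    arcs : Occ ↔ Arc
    arcs = mk↔ₛ′ arcOf (proj₁ ∘ arcOf⁻¹) (proj₂ ∘ arcOf⁻¹)
      (λ c → injective (snoc _) (snoc _) (proj₂ (arcOf⁻¹ (arcOf c))))

    cells : Occ ↔ Cell
    cells = mk↔ₛ′ tail conclusionOf (tail-conclusionOf R) (conclusionOf-tail R) ↔-∘ arcs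

-- Counting components to find the unique output conclusion

one-if-bot one-if-par : Label → ℕ
one-if-bot bot = 1
one-if-bot _   = 0
one-if-par par = 1
one-if-par _   = 0

≡par↔ : ∀ ℓ → (ℓ ≡ par) ↔ Fin (one-if-par ℓ)
≡par↔ one    = mk↔ₛ′ (λ ()) (λ ()) (λ ()) (λ ())
≡par↔ bot    = mk↔ₛ′ (λ ()) (λ ()) (λ ()) (λ ())
≡par↔ tensor = mk↔ₛ′ (λ ()) (λ ()) (λ ()) (λ ())
≡par↔ par    = mk↔ₛ′ (λ _ → zero) (λ _ → refl) (λ { zero → refl }) (λ { refl → refl })

-- The function `f` is there for the induction: the tail of `tabulate f` is `tabulate (f ∘ suc)`.
-- The number of ⟂ in `R` is the case of the identity.
length-filter-bot : ∀ {m n} (ℓ : Fin n → Label) (f : Fin m → Fin n) →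
  length (filter (bot? ∘ ℓ) (tabulate f)) ≡ sum (one-if-bot ∘ ℓ ∘ f)
length-filter-bot {zero}  ℓ f = refl
length-filter-bot {suc m} ℓ f with ℓ (f zero)
... | one    = length-filter-bot ℓ (f ∘ suc)
... | bot    = cong suc (length-filter-bot ℓ (f ∘ suc))
... | tensor = length-filter-bot ℓ (f ∘ suc)
... | par    = length-filter-bot ℓ (f ∘ suc)

mutual
  output-count : ∀ {A} → Output A → count one-if-bot A ≡ count one-if-par A
  output-count 𝟏         = refl
  output-count (O⊗O a b) = cong₂ _+_ (output-count a) (output-count b)
  output-count (O⅋I a b) = trans (cong₂ _+_ (output-count a) (input-count b)) (+-suc _ _)
  output-count (I⅋O a b) = cong₂ _+_ (input-count a) (output-count b)

  input-count : ∀ {A} → Input A → count one-if-bot A ≡ suc (count one-if-par A)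
  input-count ⟂         = refl
  input-count (I⅋I a b) = trans (cong₂ _+_ (input-count a) (input-count b)) (cong suc (+-suc _ _))
  input-count (I⊗O a b) = cong₂ _+_ (input-count a) (output-count b)
  input-count (O⊗I a b) = trans (cong₂ _+_ (output-count a) (input-count b)) (+-suc _ _)

one-if-output : ∀ {A} → ICOMLL A → ℕ
one-if-output = [ const 1 , const 0 ]′

-- The counts for outputs and inputs are merged into one linear equation, which can be summed over
-- all the conclusions.
icomll-count : ∀ {A} (w : ICOMLL A) → count one-if-bot A + one-if-output w ≡ count one-if-par A + 1
icomll-count (inj₁ a) = cong (_+ 1) (output-count a)
icomll-count (inj₂ a) = trans (+-identityʳ _) (trans (input-count a) (+-comm 1 _))

sum-one : ∀ n → sum {n} (const 1) ≡ n
sum-one zero    = refl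
sum-one (suc n) = cong suc (sum-one n)

sum≡0⇒≡0 : ∀ {n} (f : Fin n → ℕ) → sum f ≡ 0 → ∀ i → f i ≡ 0
sum≡0⇒≡0 f eq zero    = ℕ.m+n≡0⇒m≡0 (f zero) eq
sum≡0⇒≡0 f eq (suc i) = sum≡0⇒≡0 (f ∘ suc) (ℕ.m+n≡0⇒n≡0 (f zero) eq) i

sum≡1⇒∃! : ∀ {n} (f : Fin n → ℕ) → sum f ≡ 1 → ∃! _≡_ λ i → f i ≢ 0
sum≡1⇒∃! {suc n} f eq with f zero in f₀
... | suc (suc _) with () ← eq
... | suc zero = zero , (λ f₀≡0 → ℕ.0≢1+n (trans (sym f₀≡0) f₀)) ,
  λ { {zero}  _    → refl
    ; {suc j} fj≢0 → ⊥-elim (fj≢0 (sum≡0⇒≡0 (f ∘ suc) (ℕ.suc-injective eq) j)) }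
... | zero with i , fi≢0 , unique ← sum≡1⇒∃! (f ∘ suc) eq = suc i , fi≢0 ,
  λ { {zero} f₀≢0 → ⊥-elim (f₀≢0 f₀) ; {suc j} fj≢0 → cong suc (unique fj≢0) }

module _ {n : ℕ} (R : ProofStructure n) where
  open ProofStructure R

  module _ (φ : Switching R) where
    private
      V : Set
      V = Node ⊎ ParCell R
      Φ = switchingGraph R φ

    -- The arcs of a switching graph form a forest, whose roots are its • nodes.
    bullet : Fin n ⊎ ParCell R → V
    bullet = [ inj₁ ∘ inj₂ , inj₂ ]′

    data RootOf : V → Fin n ⊎ ParCell R → Set where
      here  : ∀ s → RootOf (bullet s) s
      there : ∀ {c s} a → tail a ≡ c → RootOf (switchedHead R φ a) s → RootOf (inj₁ (inj₁ c)) s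

    switchedHead-≺ : ∀ a {d} → switchedHead R φ a ≡ inj₁ (inj₁ d) → head a ≡ inj₁ d
    switchedHead-≺ a eq with head a
    switchedHead-≺ a () | inj₂ i
    switchedHead-≺ a eq | inj₁ c with par? (label c)
    switchedHead-≺ a refl | inj₁ c | no _ = refl
    switchedHead-≺ a eq   | inj₁ c | yes p with a ≟ᴬ proj₁ (φ (c , p))
    switchedHead-≺ a refl | inj₁ c | yes p | yes _ = refl

    rootOf : ∀ u → ∃ (RootOf u)
    rootOf (inj₂ m)        = inj₂ m , here (inj₂ m)
    rootOf (inj₁ (inj₂ i)) = inj₁ i , here (inj₁ i)
    rootOf (inj₁ (inj₁ c)) = cell-root c (≻-wellFounded R c)
      where
      cell-root : ∀ c → Acc (flip λ c d → inj₁ c ≺ inj₁ d) c → ∃ (RootOf (inj₁ (inj₁ c)))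
      cell-root c (acc rs) = arc-root (switchedHead R φ (conclusionOf c)) refl
        where
        via : ∀ {v} → switchedHead R φ (conclusionOf c) ≡ v → ∃ (RootOf v) → ∃ (RootOf (inj₁ (inj₁ c)))
        via refl (s , r) = s , there (conclusionOf c) (tail-conclusionOf R c) r
        arc-root : ∀ v → switchedHead R φ (conclusionOf c) ≡ v → ∃ (RootOf (inj₁ (inj₁ c)))
        arc-root (inj₂ m)        eq = via eq (inj₂ m , here (inj₂ m))
        arc-root (inj₁ (inj₂ i)) eq = via eq (inj₁ i , here (inj₁ i))
        arc-root (inj₁ (inj₁ d)) eq = via eq (cell-root d
          (rs [ conclusionOf c , cong inj₁ (tail-conclusionOf R c) , switchedHead-≺ _ eq ]))

    RootOf-cell : ∀ {u s} → RootOf u s → ∀ {c} → u ≡ inj₁ (inj₁ c) → RootOf (switchedHead R φ (conclusionOf c)) s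
    RootOf-cell (here (inj₁ _))  ()
    RootOf-cell (here (inj₂ _))  ()
    RootOf-cell (there a refl r) refl rewrite conclusionOf-tail R a = r

    RootOf-bullet : ∀ {u s t} → RootOf u s → u ≡ bullet t → s ≡ t
    RootOf-bullet {t = inj₁ _} (here (inj₁ _)) refl = refl
    RootOf-bullet {t = inj₂ _} (here (inj₂ _)) refl = refl
    RootOf-bullet {t = inj₁ _} (there _ _ _) ()
    RootOf-bullet {t = inj₂ _} (there _ _ _) ()

    RootOf-arc : ∀ a {s} → RootOf (inj₁ (inj₁ (tail a))) s → RootOf (switchedHead R φ a) s
    RootOf-arc a r = subst (λ b → RootOf (switchedHead R φ b) _) (conclusionOf-tail R a) (RootOf-cell r refl)

    -- A cell has a single outgoing arc, so both ends of an arc lead down to the same root,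
    -- whichever way the arc is traversed.
    RootOf-path : ∀ {u v s} → UndirectedPath Φ u v → RootOf u s → RootOf v s
    RootOf-path []                             r = r
    RootOf-path ((a , inj₁ (refl , refl)) ∷ p) r = RootOf-path p (RootOf-arc a r)
    RootOf-path ((a , inj₂ (refl , refl)) ∷ p) r = RootOf-path p (there a refl r)

    path-to-root : ∀ {u s} → RootOf u s → UndirectedPath Φ u (bullet s)
    path-to-root (here s)         = []
    path-to-root (there a refl r) = (a , inj₁ (refl , refl)) ∷ path-to-root r

    -- The path down from any node reaches a • node of its component, and invariance of the root
    -- along paths prevents two • nodes from sharing a component.
    bullets : ∀ {k} → HasConnectedComponents Φ k → (Fin n ⊎ ParCell R) ↔ Fin k
    bullets (component , surjective , connected) = mk↔ₛ′ (component ∘ bullet) root-of-component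
      (λ k → trans (sym (Equivalence.from (connected _ _) (path-to-root (proj₂ (rootOf (proj₁ (surjective k)))))))
                   (proj₂ (surjective k)))
      (λ s → RootOf-bullet (RootOf-path (Equivalence.to (connected _ _) (proj₂ (surjective (component (bullet s)))))
                                        (proj₂ (rootOf (proj₁ (surjective (component (bullet s))))))) refl)
      where
      root-of-component : Fin _ → Fin n ⊎ ParCell R
      root-of-component k = proj₁ (rootOf (proj₁ (surjective k)))

  -- A concrete switching at which the criterion is evaluated to obtain the number of components.
  leftSwitching : Switching R
  leftSwitching (c , p) = premise c (subst (Fin ∘ arity) (sym p) zero) , premise-head c _

  private
    A : Fin n → Formula
    A i = type (conclusion i)

  cells-count : ∀ q → Σ Cell (Fin ∘ q ∘ label) ↔ Fin (sum (count q ∘ A))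
  cells-count q =
    Σ-finite (↔-id _) (count q ∘ A) (λ i → Pos-count q (A i)) ↔-∘
    Σ-assoc ↔-∘
    ↔-sym (Σ-↔ (cells R A (↔-id _) (λ _ → refl))
               (λ {c} → Fin-cong (cong q (label-arcOf R A (↔-id _) (λ _ → refl) c))))

  ♯w-count : ♯w ≡ sum (count one-if-bot ∘ A)
  ♯w-count = trans (length-filter-bot (label ∘ Inverse.from (proj₂ cells-finite)) id)
    (↔⇒≡ (cells-count one-if-bot ↔-∘
          ↔-sym (Σ-finite (proj₂ cells-finite) (one-if-bot ∘ label) (λ _ → ↔-id _))))

  ParCell-count : ParCell R ↔ Fin (sum (count one-if-par ∘ A))
  ParCell-count = cells-count one-if-par ↔-∘ Σ-↔ (↔-id _) (λ {c} → ≡par↔ (label c))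

  -- Summing `icomll-count` gives: ⟂ plus output conclusions equal ⅋ plus conclusions. The right
  -- side is the number of • nodes of a switching graph, hence of its components, and by the
  -- criterion this is the number of ⟂ plus one. Cancelling the ⟂ leaves one output.
  one-output : ACC♯w R → sum (λ i → one-if-output (icomll (conclusion i))) ≡ 1
  one-output correct = ℕ.+-cancelˡ-≡ (sum (count one-if-bot ∘ A)) _ _ (begin
    sum (count one-if-bot ∘ A) + sum (one-if-output ∘ w)     ≡⟨ ∑-distrib-+ (count one-if-bot ∘ A) (one-if-output ∘ w) ⟨
    sum (λ i → count one-if-bot (A i) + one-if-output (w i)) ≡⟨ sum-cong-≗ (icomll-count ∘ w) ⟩
    sum (λ i → count one-if-par (A i) + 1)                   ≡⟨ ∑-distrib-+ (count one-if-par ∘ A) (const 1) ⟩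
    sum (count one-if-par ∘ A) + sum {n} (const 1)           ≡⟨ cong (sum (count one-if-par ∘ A) +_) (sum-one n) ⟩
    sum (count one-if-par ∘ A) + n                           ≡⟨ +-comm _ n ⟩
    n + sum (count one-if-par ∘ A)                           ≡⟨ ↔⇒≡ (bullets leftSwitching (proj₂ (correct leftSwitching)) ↔-∘
                                                                 (↔-id _ ⊎-↔ ↔-sym ParCell-count) ↔-∘ +↔⊎ {n}) ⟩
    ♯w + 1                                                   ≡⟨ cong (_+ 1) ♯w-count ⟩
    sum (count one-if-bot ∘ A) + 1                           ∎)
    where
    open ≡-Reasoning
    w : ∀ i → ICOMLL (A i)
    w i = icomll (conclusion i)

  uniqueOutput : ACC♯w R → UniqueOutput R
  uniqueOutput correct with i , ≢0 , unique ← sum≡1⇒∃! _ (one-output correct) =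
    i , ≢0⇒output (icomll (conclusion i)) ≢0 , λ {j} o → unique (output⇒≢0 (icomll (conclusion j)) o)
    where
    ≢0⇒output : ∀ {A} (w : ICOMLL A) → one-if-output w ≢ 0 → Output A
    ≢0⇒output (inj₁ o) _   = o
    ≢0⇒output (inj₂ _) ≢0 = ⊥-elim (≢0 refl)
    output⇒≢0 : ∀ {A} (w : ICOMLL A) → Output A → one-if-output w ≢ 0
    output⇒≢0 (inj₂ i) o _ = output-input R o i

-- Jumps computed on positions are the canonical ones

≅-sym : ∀ {n} {S T : Structure n} → S ≅ T → T ≅ S
≅-sym {S = S} {T} f = record
  { cells      = ↔-sym f.cells
  ; arcs       = ↔-sym f.arcs
  ; label      = λ c → trans (sym (f.label (cell⁻¹ c))) (cong T.label (Inverse.strictlyInverseˡ f.cells c))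
  ; tail       = λ a → trans (sym (Inverse.strictlyInverseʳ f.cells _))
                   (cong cell⁻¹ (trans (sym (f.tail _)) (cong T.tail (Inverse.strictlyInverseˡ f.arcs a))))
  ; head       = λ a → trans (sym (node-inverse _))
                   (cong (Sum.map₁ cell⁻¹) (trans (sym (f.head _)) (cong T.head (Inverse.strictlyInverseˡ f.arcs a))))
  ; premise    = λ c → premise (cell⁻¹ c) c (Inverse.strictlyInverseˡ f.cells c)
  ; conclusion = λ i → sym (trans (cong arc⁻¹ (f.conclusion i)) (Inverse.strictlyInverseʳ f.arcs _))
  ; type       = λ a → trans (sym (f.type (arc⁻¹ a))) (cong T.type (Inverse.strictlyInverseˡ f.arcs a))
  ; jump       = λ c → jump (cell⁻¹ c) c (Inverse.strictlyInverseˡ f.cells c)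
  }
  where
  module S = Structure S
  module T = Structure T
  module f = _≅_ f
  cell⁻¹ = Inverse.from f.cells
  arc⁻¹  = Inverse.from f.arcs

  node-inverse : ∀ v → Sum.map₁ cell⁻¹ (f.node v) ≡ v
  node-inverse (inj₁ c) = cong inj₁ (Inverse.strictlyInverseʳ f.cells c)
  node-inverse (inj₂ _) = refl

  premise : ∀ d c → f.cell d ≡ c → ∀ i j → toℕ i ≡ toℕ j → S.premise d j ≡ arc⁻¹ (T.premise c i)
  premise d _ refl i j h =
    sym (trans (cong arc⁻¹ (f.premise d j i (sym h))) (Inverse.strictlyInverseʳ f.arcs _))

  map-node-inverse : ∀ m → Maybe.map (Sum.map₁ cell⁻¹) (Maybe.map f.node m) ≡ m
  map-node-inverse nothing  = refl
  map-node-inverse (just v) = cong just (node-inverse v)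

  jump : ∀ d c → f.cell d ≡ c → ∀ p q → S.jump d q ≡ Maybe.map (Sum.map₁ cell⁻¹) (T.jump c p)
  jump d _ refl p q =
    sym (trans (cong (Maybe.map (Sum.map₁ cell⁻¹)) (f.jump d q p)) (map-node-inverse (S.jump d q)))

module _ {n : ℕ} (R : ProofStructure n) where
  open ProofStructure R

  output-premise-unique : ∀ ℓ (A : Fin (arity ℓ) → Formula) → ℓ ≡ par → Output (conclusionType ℓ A) →
                          ∀ i j → Output (A i) → Output (A j) → i ≡ j
  output-premise-unique par A refl _ zero       zero       _ _ = refl
  output-premise-unique par A refl _ (suc zero) (suc zero) _ _ = refl
  output-premise-unique par A refl (O⅋I _ b) zero       (suc zero) _ o = ⊥-elim (output-input R o b)
  output-premise-unique par A refl (O⅋I _ b) (suc zero) zero       o _ = ⊥-elim (output-input R o b)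
  output-premise-unique par A refl (I⅋O a _) zero       (suc zero) o _ = ⊥-elim (output-input R o a)
  output-premise-unique par A refl (I⅋O a _) (suc zero) zero       _ o = ⊥-elim (output-input R o a)

  TensorOf-unique : ∀ {m t u} → TensorOf R m t → TensorOf R m u → t ≡ u
  TensorOf-unique (one _)      (one _)             = refl
  TensorOf-unique (tensor _ _) (tensor _ _)        = refl
  TensorOf-unique (one p)      (tensor q _)        with () ← trans (sym p) q
  TensorOf-unique (tensor p _) (one q)             with () ← trans (sym p) q
  TensorOf-unique (one p)      (par (q , _) _ _ _) with () ← trans (sym p) q
  TensorOf-unique (tensor p _) (par (q , _) _ _ _) with () ← trans (sym p) q
  TensorOf-unique (par (p , _) _ _ _) (one q)      with () ← trans (sym p) q
  TensorOf-unique (par (p , _) _ _ _) (tensor q _) with () ← trans (sym p) q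
  TensorOf-unique {m} (par (p , o) i oᵢ d) (par _ j oⱼ d′)
    with refl ← output-premise-unique (label m) (type ∘ premise m) p (subst Output (typed-cell R m) o) i j oᵢ oⱼ =
    TensorOf-unique d d′

  least-unique : ∀ {c m m′} → IsLeastOutputParBelow R c m → IsLeastOutputParBelow R c m′ → m ≡ m′
  least-unique {m = m} {m′} (o , c≺m , least) (o′ , c≺m′ , least′) with least m′ o′ c≺m′ | least′ m o c≺m
  ... | inj₁ eq | _       = eq
  ... | inj₂ _  | inj₁ eq = sym eq
  ... | inj₂ p  | inj₂ q  = ⊥-elim (acyclic _ (p Plus.++ q))

  outputCell : ∀ {A} → Output A → ∀ e → type e ≡ A → OutputCell R (tail e)
  outputCell a e eq = subst Output (trans (sym eq) (cong type (sym (conclusionOf-tail R e)))) a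

  TensorOf-arcAt : ∀ {A} (a : Output A) e (eq : type e ≡ A) →
                   TensorOf R (tail e) (tail (arcAt R e eq (tensorPos a)))
  TensorOf-arcAt 𝟏         e eq = one (sym (lab-type R e eq))
  TensorOf-arcAt (O⊗O a b) e eq = tensor (sym (lab-type R e eq)) (outputCell (O⊗O a b) e eq)
  TensorOf-arcAt (O⅋I a b) e eq = par (sym (lab-type R e eq) , outputCell (O⅋I a b) e eq) _
    (subst Output (sym (type-branch R e eq zero)) a)
    (TensorOf-arcAt a (branch R e eq zero) (type-branch R e eq zero))
  TensorOf-arcAt (I⅋O a b) e eq = par (sym (lab-type R e eq) , outputCell (I⅋O a b) e eq) _
    (subst Output (sym (type-branch R e eq (suc zero))) b)
    (TensorOf-arcAt b (branch R e eq (suc zero)) (type-branch R e eq (suc zero)))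

  module _ (o : UniqueOutput R) where

    -- The jumps of `⟨ R ⟩w` come out of a search. Determinism makes it enough to show that the
    -- jumps computed on positions satisfy the defining relation.
    CanonicalJump-unique : ∀ {c t u} → CanonicalJump R o c t → CanonicalJump R o c u → t ≡ u
    CanonicalJump-unique (below l d)      (below l′ d′) with refl ← least-unique l l′ = TensorOf-unique d d′
    CanonicalJump-unique (default _ d)    (default _ d′)               = TensorOf-unique d d′
    CanonicalJump-unique (below {m} (p , c≺m , _) _) (default none _) = ⊥-elim (none m p c≺m)
    CanonicalJump-unique (default none _) (below {m} (p , c≺m , _) _) = ⊥-elim (none m p c≺m)

    module _ {c d : Cell} (h : head (conclusionOf c) ≡ inj₁ d) where
      private
        c≺d : inj₁ c ≺ inj₁ d
        c≺d = [ conclusionOf c , cong inj₁ (tail-conclusionOf R c) , h ]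

      -- What lies below `c` is `d` and what lies below `d`; when `d` is not an output ⅋, both cells
      -- have the same output ⅋ below them.
      CanonicalJump-step : ∀ {t} → ¬ OutputPar R d → CanonicalJump R o d t → CanonicalJump R o c t
      CanonicalJump-step ¬o (below (p , d≺m , least) r) = below
        (p , c≺d Plus.++ d≺m , λ m′ o′ c≺m′ →
          [ (λ { refl → ⊥-elim (¬o o′) }) , least m′ o′ ]′ (first-step R h c≺m′)) r
      CanonicalJump-step ¬o (default none r) = default
        (λ m o′ c≺m → [ (λ { refl → ¬o o′ }) , none m o′ ]′ (first-step R h c≺m)) r

      -- Every other node below `c` is below `d`, so an output ⅋ at `d` is the least one.
      CanonicalJump-stop : ∀ {t} → OutputPar R d → TensorOf R d t → CanonicalJump R o c t
      CanonicalJump-stop p = below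
        (p , c≺d , λ m′ _ c≺m′ → Sum.map₁ inj₁-injective (first-step R h c≺m′))

    CanonicalJump-end : ∀ {c i t} → head (conclusionOf c) ≡ inj₂ i →
                        TensorOf R (tail (conclusion (proj₁ o))) t → CanonicalJump R o c t
    CanonicalJump-end h = default (λ m _ c≺m → [ (λ ()) , bullet-final R ]′ (first-step R h c≺m))

    head-branch : ∀ {A} e (eq : type e ≡ A) i → head (conclusionOf (tail (branch R e eq i))) ≡ inj₁ (tail e)
    head-branch e eq i = trans (cong head (conclusionOf-tail R _)) (premise-head _ _)

    -- In an input formula the occurrences without a jump inherit that of the root.

    mutual
      CanonicalJump-jumpO : ∀ {A} (a : Output A) e (eq : type e ≡ A) p → labelAt p ≡ bot →
        CanonicalJump R o (tail (arcAt R e eq p)) (tail (arcAt R e eq (jumpO a p)))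
      CanonicalJump-jumpO 𝟏         e eq root ()
      CanonicalJump-jumpO (O⊗O a b) e eq root ()
      CanonicalJump-jumpO (O⅋I a b) e eq root ()
      CanonicalJump-jumpO (I⅋O a b) e eq root ()
      CanonicalJump-jumpO (O⊗O a b) e eq (sub zero p)       = CanonicalJump-jumpO a _ _ p
      CanonicalJump-jumpO (O⊗O a b) e eq (sub (suc zero) p) = CanonicalJump-jumpO b _ _ p
      CanonicalJump-jumpO (O⅋I a b) e eq (sub zero p)       = CanonicalJump-jumpO a _ _ p
      CanonicalJump-jumpO (O⅋I a b) e eq (sub (suc zero) p) ⟂p =
        subst (CanonicalJump R o _) (sym (maybe′-natural (tail ∘ arcAt R e eq) (jumpI b p)))
          -- The root of the input premise sits directly above this output ⅋, so its jump is the m_⊗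
          -- of the ⅋; the ⟂ without an internal jump receive it from there.
          (CanonicalJump-jumpI b _ _ p ⟂p (CanonicalJump-stop (head-branch e eq (suc zero))
            (sym (lab-type R e eq) , outputCell (O⅋I a b) e eq) (TensorOf-arcAt (O⅋I a b) e eq)))
      CanonicalJump-jumpO (I⅋O a b) e eq (sub zero p) ⟂p =
        subst (CanonicalJump R o _) (sym (maybe′-natural (tail ∘ arcAt R e eq) (jumpI a p)))
          (CanonicalJump-jumpI a _ _ p ⟂p (CanonicalJump-stop (head-branch e eq zero)
            (sym (lab-type R e eq) , outputCell (I⅋O a b) e eq) (TensorOf-arcAt (I⅋O a b) e eq)))
      CanonicalJump-jumpO (I⅋O a b) e eq (sub (suc zero) p) = CanonicalJump-jumpO b _ _ p

      CanonicalJump-jumpI : ∀ {A} (a : Input A) e (eq : type e ≡ A) p → labelAt p ≡ bot → ∀ {t} →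
        CanonicalJump R o (tail e) t →
        CanonicalJump R o (tail (arcAt R e eq p)) (maybe′ (tail ∘ arcAt R e eq) t (jumpI a p))
      CanonicalJump-jumpI ⟂         e eq root _ d = d
      CanonicalJump-jumpI (I⅋I a b) e eq (sub zero p) ⟂p d =
        CanonicalJump-branch (I⅋I a b) zero a e eq p ⟂p d
      CanonicalJump-jumpI (I⅋I a b) e eq (sub (suc zero) p) ⟂p d =
        CanonicalJump-branch (I⅋I a b) (suc zero) b e eq p ⟂p d
      CanonicalJump-jumpI (I⊗O a b) e eq (sub zero p) ⟂p d =
        CanonicalJump-branch (I⊗O a b) zero a e eq p ⟂p d
      CanonicalJump-jumpI (I⊗O a b) e eq (sub (suc zero) p) ⟂p d = CanonicalJump-jumpO b _ _ p ⟂p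
      CanonicalJump-jumpI (O⊗I a b) e eq (sub zero p) ⟂p d = CanonicalJump-jumpO a _ _ p ⟂p
      CanonicalJump-jumpI (O⊗I a b) e eq (sub (suc zero) p) ⟂p d =
        CanonicalJump-branch (O⊗I a b) (suc zero) b e eq p ⟂p d

      CanonicalJump-branch : ∀ {A} (a : Input A) i (b : Input (child A i)) e (eq : type e ≡ A) p →
        labelAt p ≡ bot → ∀ {t} → CanonicalJump R o (tail e) t →
        CanonicalJump R o (tail (arcAt R e eq (sub i p)))
          (maybe′ (tail ∘ arcAt R e eq) t (Maybe.map (sub i) (jumpI b p)))
      CanonicalJump-branch a i b e eq p ⟂p d =
        subst (CanonicalJump R o _) (sym (maybe′-map (jumpI b p) (λ _ → refl)))
          (CanonicalJump-jumpI b _ _ p ⟂p (CanonicalJump-step (head-branch e eq i)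
            -- The parent has an input type, so it is not an output ⅋ and the premise has the same
            -- canonical jump.
            (λ (_ , out) → output-input R out (subst Input (trans (sym eq) (cong type (sym (conclusionOf-tail R e)))) a)) d))

-- Assembly of the whole forest from its output and its inputs

module _ (F : Forest) (t : Forest.Occ F) where
  open Forest F using (Tree; formula; wf; size; enum; jumpTo)

  -- For the input conclusions of `R`: their ⟂ with no output ⅋ below all take the default jump,
  -- hence the common target `t`.
  addInputs : ∀ m (B : Fin m → Formula) → (∀ i → Input (B i)) → Forest
  addInputs m B b = record
    { Tree    = Tree ⊎ Fin m
    ; formula = [ formula , B ]′
    ; wf      = λ { (inj₁ x) → wf x ; (inj₂ i) → inj₂ (b i) }
    ; size    = size + m
    ; enum    = ↔-sym (+↔⊎ {size} {m}) ↔-∘ (enum ⊎-↔ ↔-id _)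
    ; jumpTo  = λ { (inj₁ x , p) → let y , q = jumpTo (x , p) in inj₁ y , q
                  ; (inj₂ i , p) → maybe′ (inj₂ i ,_) (inj₁ (proj₁ t) , proj₂ t) (jumpI (b i) p) }
    }

  addInputs-provable : ∀ m B b → ForestProvable F → ForestProvable (addInputs m B b)
  addInputs-provable zero B b d =
    ForestProvable-relabel (addInputs zero B b) F none same (λ { (inj₁ _ , _) → refl ; (inj₂ () , _) }) d
    where
    none : (Tree ⊎ Fin 0) ↔ Tree
    none = mk↔ₛ′ [ id , (λ ()) ]′ inj₁ (λ _ → refl) (λ { (inj₁ _) → refl ; (inj₂ ()) })
    same : ∀ x → [ formula , B ]′ x ≡ formula (Inverse.to none x)
    same (inj₁ _) = refl
  addInputs-provable (suc m) B b d =
    ForestProvable-relabel G H last same jumps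
      (input-provable (addInputs m (B ∘ suc) (b ∘ suc)) (b zero) t′
        (addInputs-provable m (B ∘ suc) (b ∘ suc) d))
    where
    t′ : Forest.Occ (addInputs m (B ∘ suc) (b ∘ suc))
    t′ = inj₁ (proj₁ t) , proj₂ t
    G H : Forest
    G = addInputs (suc m) B b
    H = addInput (addInputs m (B ∘ suc) (b ∘ suc)) (b zero) t′
    last : (Tree ⊎ Fin (suc m)) ↔ ((Tree ⊎ Fin m) ⊎ ⊤)
    last = mk↔ₛ′
      (λ { (inj₁ x) → inj₁ (inj₁ x) ; (inj₂ zero) → inj₂ tt ; (inj₂ (suc i)) → inj₁ (inj₂ i) })
      (λ { (inj₁ (inj₁ x)) → inj₁ x ; (inj₂ tt) → inj₂ zero ; (inj₁ (inj₂ i)) → inj₂ (suc i) })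
      (λ { (inj₁ (inj₁ x)) → refl ; (inj₂ tt) → refl ; (inj₁ (inj₂ i)) → refl })
      (λ { (inj₁ x) → refl ; (inj₂ zero) → refl ; (inj₂ (suc i)) → refl })
    same : ∀ x → Forest.formula G x ≡ Forest.formula H (Inverse.to last x)
    same (inj₁ _)       = refl
    same (inj₂ zero)    = refl
    same (inj₂ (suc _)) = refl
    jumps : ∀ c → Forest.jumpTo H (Inverse.to (relabel G H last same) c) ≡
                  Inverse.to (relabel G H last same) (Forest.jumpTo G c)
    jumps (inj₁ _ , _)       = refl
    jumps (inj₂ zero , p)    = sym (maybe′-natural (Inverse.to (relabel G H last same)) (jumpI (b zero) p))
    jumps (inj₂ (suc i) , p) = trans
      (maybe′-natural (old (addInputs m (B ∘ suc) (b ∘ suc))) (jumpI (b (suc i)) p))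
      (sym (maybe′-natural (Inverse.to (relabel G H last same)) (jumpI (b (suc i)) p)))

module _ {n : ℕ} (R : ProofStructure n) (o : UniqueOutput R) (F : Forest) (e : Forest.Tree F ↔ Fin n) where
  open ProofStructure R
  open Forest F using (Tree; formula; Occ; jumpTo)

  module _ (same : ∀ x → type (conclusion (Inverse.to e x)) ≡ formula x) where
    private
      arc : Occ → Arc
      arc = arcOf R formula e same

    -- Apart from the jumps, `R` is the forest of its conclusions. Jumps are compared at occurrences
    -- of ⟂ only, `jumpTo` being arbitrary elsewhere.
    canonical-≅ : (∀ c → labelAt (proj₂ c) ≡ bot → CanonicalJump R o (tail (arc c)) (tail (arc (jumpTo c)))) →
                  forestStructure F e ≅ ProofStructure.structure (⟨ R ⟩w o)
    canonical-≅ canonical = record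
      { cells      = cells R formula e same
      ; arcs       = arcs R formula e same
      ; label      = λ c → sym (label-arcOf R formula e same c)
      ; tail       = λ _ → refl
      ; head       = λ (x , p) → trans (head-arcOf R formula e same x p) (node-parent x p)
      ; premise    = λ (x , p) i j h → sym (premise-arcOf R formula e same x p i j h)
      ; conclusion = λ i → cong conclusion (sym (Inverse.strictlyInverseˡ e i))
      ; type       = type-arcOf R formula e same
      ; jump       = λ c p _ → cong (just ∘ inj₁)
          (CanonicalJump-unique R o (proj₂ (canonicalJump R o (tail (arc c)))) (canonical c p))
      }
      where
      node-parent : ∀ x p → maybe′ (λ q → inj₁ (tail (arc (x , q)))) (inj₂ (Inverse.to e x)) (parent p) ≡
                    Sum.map₁ (tail ∘ arc) (Structure.head (forestStructure F e) (x , p))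
      node-parent x p with parent p
      ... | just _  = refl
      ... | nothing = refl

module _ {m : ℕ} (R : ProofStructure (suc m)) (o : UniqueOutput R) where
  open ProofStructure R
  private
    i₀  = proj₁ o
    out = proj₁ (proj₂ o)

  other-input : ∀ j → Input (type (conclusion (punchIn i₀ j)))
  other-input j with icomll (conclusion (punchIn i₀ j))
  ... | inj₂ a = a
  ... | inj₁ a = ⊥-elim (punchInᵢ≢i i₀ j (sym (proj₂ (proj₂ o) a)))

  -- The summand `⊥ ⊎ ⊤` is the set of trees of `outputForest`, the empty forest with one tree
  -- added. The trees are listed in the order of construction and sent to their places in `R`, with
  -- `punchIn i₀` skipping the place of the output.
  output-first : ((⊥ ⊎ ⊤) ⊎ Fin m) ↔ Fin (suc m)
  output-first = mk↔ₛ′ to from to-from from-to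
    where
    to : (⊥ ⊎ ⊤) ⊎ Fin m → Fin (suc m)
    to (inj₁ _) = i₀
    to (inj₂ j) = punchIn i₀ j
    from : Fin (suc m) → (⊥ ⊎ ⊤) ⊎ Fin m
    from k with i₀ ≟ k
    ... | yes _   = inj₁ (inj₂ tt)
    ... | no i₀≢k = inj₂ (punchOut i₀≢k)
    to-from : ∀ k → to (from k) ≡ k
    to-from k with i₀ ≟ k
    ... | yes eq  = eq
    ... | no i₀≢k = punchIn-punchOut i₀≢k
    from-to : ∀ x → from (to x) ≡ x
    from-to (inj₁ (inj₂ tt)) with i₀ ≟ i₀
    ... | yes _ = refl
    ... | no ≢i₀ = ⊥-elim (≢i₀ refl)
    from-to (inj₂ j) with i₀ ≟ punchIn i₀ j
    ... | yes eq = ⊥-elim (punchInᵢ≢i i₀ j (sym eq))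
    ... | no ≢   = cong inj₂ (trans (punchOut-cong i₀ refl) (punchOut-punchIn i₀))

  canonicalForest : Forest
  canonicalForest = addInputs (outputForest out) (new ∅ (tensorPos out)) m _ other-input

  canonicalForest-≅ : forestStructure canonicalForest output-first ≅ ProofStructure.structure (⟨ R ⟩w o)
  canonicalForest-≅ = canonical-≅ R o canonicalForest output-first same canonical
    where
    same : ∀ x → type (conclusion (Inverse.to output-first x)) ≡ Forest.formula canonicalForest x
    same (inj₁ (inj₂ tt)) = refl
    same (inj₂ _)         = refl
    arc : Forest.Occ canonicalForest → Arc
    arc = arcOf R (Forest.formula canonicalForest) output-first same
    canonical : ∀ c → labelAt (proj₂ c) ≡ bot →
                CanonicalJump R o (tail (arc c)) (tail (arc (Forest.jumpTo canonicalForest c)))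
    canonical (inj₁ (inj₂ tt) , p) ⟂p = CanonicalJump-jumpO R o out _ refl p ⟂p
    canonical (inj₂ j , p) ⟂p = subst (CanonicalJump R o _)
      (sym (maybe′-natural (tail ∘ arc) (jumpI (other-input j) p)))
      (CanonicalJump-jumpI R o (other-input j) _ refl p ⟂p
        -- Only a • node lies below the root of an input conclusion, so its jump is the default one,
        -- which the ⟂ without an internal jump inherit.
        (CanonicalJump-end R o (trans (cong head (conclusionOf-tail R _)) (conclusion-head _))
          (TensorOf-arcAt R out _ refl)))

sequentialization : ∀ {n} (R : ProofStructure n) (o : UniqueOutput R) → Derivable (⟨ R ⟩w o)
sequentialization {zero}  R (() , _)
sequentialization {suc m} R o
  with derivation d ← reorder (canonicalForest R o) (Forest.enum (canonicalForest R o)) (output-first R o)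
         (addInputs-provable _ _ m _ (other-input R o) (output-provable (proj₁ (proj₂ o)))) =
  Derivable-resp-≅ (≅-sym (canonicalForest-≅ R o)) d

theorem82 : ∀ {n : ℕ} (R : ProofStructure n) → JumpFree R → ACC♯w R →
            Σ[ o ∈ UniqueOutput R ] Σ[ Γ ∈ Vec Formula n ] Σ[ π ∈ ⊢ Γ ] π ∣⇒ ⟨ R ⟩w o
theorem82 R _ correct = uniqueOutput R correct , sequentialization R (uniqueOutput R correct)
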